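{- Let $B$ be a finite left regular band monoid and $\Bbbk$ a commutative ring with unit. Then $\mathrm{cd}_\Bbbk B$ is the largest $n$ such that $\tilde H^{n-1}(\Delta(\partial e_YB);\Bbbk)\ne0$ for some $Y\in\Lambda(B)$, where $e_Y\in B$ satisfies $Be_Y=Y$.
   Context: A left regular band monoid is a finite monoid $B$ with $x^2=x$, $xyx=xy$, ordered by $a\le b$ iff $ba=a$; $\Lambda(B)=\{Bb\mid b\in B\}$; $\Delta(\cdot)$ is the order complex (simplicial complex of chains); $\partial aB=aB\setminus\{a\}$. Reduced cohomology convention: $\tilde H^{ -1}(\emptyset;\Bbbk)=\Bbbk$ and $\tilde H^{ -1}(Z;\Bbbk)=0$ for $Z\ne\emptyset$. For a $\Bbbk B$-module $V$, $H^n(B,V)=\mathrm{Ext}^n_{\Bbbk B}(\Bbbk,V)$ with $\Bbbk$ the trivial module, and $\mathrm{cd}_\Bbbk B=\sup\{n\mid H^n(B,V)\ne0\text{ for some }\Bbbk B\text{ -module }V\}$. -}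

module Defs where

open import Level using (Level; _⊔_; 0ℓ) renaming (suc to lsuc)
open import Data.Nat using (ℕ; zero; suc; _≤_)
open import Data.Fin using (Fin; zero; suc)
open import Data.Vec using (Vec; []; _∷_; removeAt; init)
open import Data.Product using (Σ; ∃; ∃-syntax; _×_; _,_)
open import Data.Unit using (⊤)
open import Relation.Nullary using (¬_)
open import Relation.Binary.PropositionalEquality using (_≡_)
open import Algebra.Bundles using (CommutativeRing)
open import Algebra.Structures using (IsMonoid)
open import Algebra.Module.Bundles using (LeftModule)
open import Function.Bundles using (_↔_)

fsum : ∀ {a} {A : Set a} → (A → A → A) → A → ∀ {n} → (Fin n → A) → A
fsum _+_ z {zero}  f = z
fsum _+_ z {suc n} f = f zero + fsum _+_ z (λ i → f (suc i))

signed : ∀ {a} {A : Set a} → (A → A) → ℕ → A → A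
signed neg zero    x = x
signed neg (suc k) x = neg (signed neg k x)

record FiniteLRBMonoid : Set₁ where
  infixl 7 _∙_
  field
    Carrier  : Set
    _∙_      : Carrier → Carrier → Carrier
    ε        : Carrier
    isMonoid : IsMonoid _≡_ _∙_ ε
    idem     : ∀ x → x ∙ x ≡ x
    lrb      : ∀ x y → x ∙ y ∙ x ≡ x ∙ y
    size     : ℕ
    enum     : Carrier ↔ Fin size

  _≤B_ : Carrier → Carrier → Set
  a ≤B b = b ∙ a ≡ a

  _<B_ : Carrier → Carrier → Set
  a <B b = (a ≤B b) × ¬ (a ≡ b)

  In∂ : Carrier → Carrier → Set
  In∂ e x = (∃[ b ] e ∙ b ≡ x) × ¬ (x ≡ e)

  -- strictly increasing chains x₀ < x₁ < … < x_{m-1} in ∂ eB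
  -- (the empty chain is allowed: it indexes the augmentation, degree -1)
  IsChain : Carrier → ∀ {m} → Vec Carrier m → Set
  IsChain e []           = ⊤
  IsChain e (x ∷ [])     = In∂ e x
  IsChain e (x ∷ y ∷ xs) = In∂ e x × x <B y × IsChain e (y ∷ xs)

-- Reduced simplicial cohomology of Δ(∂ eB) with coefficients in 𝕜.
-- A cochain of degree m-1 is a function on chains with m vertices
-- (only its values on chains matter); degree -1 (m = 0) is the
-- augmentation 𝕜 (the empty chain).

module ReducedCohomology {c ℓ} (𝕜 : CommutativeRing c ℓ) (B : FiniteLRBMonoid) where
  open CommutativeRing 𝕜
  open FiniteLRBMonoid B using (IsChain) renaming (Carrier to ∣B∣)

  Cochain : ℕ → Set c
  Cochain m = Vec ∣B∣ m → Carrier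

  δ : ∀ {m} → Cochain m → Cochain (suc m)
  δ φ xs = fsum _+_ 0# (λ i → signed -_ (Data.Fin.toℕ i) (φ (removeAt xs i)))

  IsCocycle : (e : ∣B∣) → ∀ {m} → Cochain m → Set ℓ
  IsCocycle e {m} φ = ∀ (xs : Vec ∣B∣ (suc m)) → IsChain e xs → δ φ xs ≈ 0#

  IsCoboundary : (e : ∣B∣) → ∀ {m} → Cochain m → Set (c ⊔ ℓ)
  IsCoboundary e {zero}  φ = Level.Lift c (φ [] ≈ 0#)
  IsCoboundary e {suc m} φ = ∃[ ψ ] (∀ (xs : Vec ∣B∣ (suc m)) → IsChain e xs → δ ψ xs ≈ φ xs)

  -- H̃^{n-1}(Δ(∂ eB); 𝕜) ≠ 0
  ReducedNonzero : (e : ∣B∣) → ℕ → Set (c ⊔ ℓ)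
  ReducedNonzero e n = ∃[ φ ] (IsCocycle e {n} φ × ¬ IsCoboundary e {n} φ)

record KBModule {c ℓ} (𝕜 : CommutativeRing c ℓ) (B : FiniteLRBMonoid) m ℓm
       : Set (c ⊔ ℓ ⊔ lsuc (m ⊔ ℓm)) where
  open CommutativeRing 𝕜 using (ring; Carrier)
  open FiniteLRBMonoid B using (_∙_; ε) renaming (Carrier to ∣B∣)
  field
    kmodule : LeftModule ring m ℓm
  open LeftModule kmodule
  infixr 7 _▷_
  field
    _▷_      : ∣B∣ → Carrierᴹ → Carrierᴹ
    ▷-cong   : ∀ b {v w} → v ≈ᴹ w → b ▷ v ≈ᴹ b ▷ w
    ▷-ε      : ∀ v → ε ▷ v ≈ᴹ v
    ▷-assoc  : ∀ a b v → (a ∙ b) ▷ v ≈ᴹ a ▷ (b ▷ v)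
    ▷-+      : ∀ b v w → b ▷ (v +ᴹ w) ≈ᴹ (b ▷ v) +ᴹ (b ▷ w)
    ▷-*ₗ     : ∀ b (r : Carrier) v → b ▷ (r *ₗ v) ≈ᴹ r *ₗ (b ▷ v)

-- H^n(B, V) = Ext^n_{𝕜B}(𝕜, V), computed by the (unnormalised) bar
-- resolution of the trivial module 𝕜: cochains are functions Bⁿ → V.

module MonoidCohomology {c ℓ m ℓm} {𝕜 : CommutativeRing c ℓ} {B : FiniteLRBMonoid}
         (V : KBModule 𝕜 B m ℓm) where
  open FiniteLRBMonoid B using (_∙_) renaming (Carrier to ∣B∣)
  open KBModule V
  open LeftModule kmodule

  BCochain : ℕ → Set m
  BCochain n = Vec ∣B∣ n → Carrierᴹ

  mergeAt : ∀ {n} → Fin n → Vec ∣B∣ (suc n) → Vec ∣B∣ n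
  mergeAt zero    (x ∷ y ∷ xs) = (x ∙ y) ∷ xs
  mergeAt (suc i) (x ∷ xs@(_ ∷ _)) = x ∷ mergeAt i xs

  ∂ : ∀ {n} → BCochain n → BCochain (suc n)
  ∂ {n} f (b ∷ bs) =
    (b ▷ f bs)
    +ᴹ (fsum _+ᴹ_ 0ᴹ (λ i → signed -ᴹ_ (suc (Data.Fin.toℕ i)) (f (mergeAt i (b ∷ bs))))
    +ᴹ signed -ᴹ_ (suc n) (f (init (b ∷ bs))))

  IsBCocycle : ∀ {n} → BCochain n → Set (ℓm)
  IsBCocycle f = ∀ bs → ∂ f bs ≈ᴹ 0ᴹ

  IsBCoboundary : ∀ {n} → BCochain n → Set (m ⊔ ℓm)
  IsBCoboundary {zero}  f = Level.Lift m (∀ bs → f bs ≈ᴹ 0ᴹ)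
  IsBCoboundary {suc n} f = ∃[ g ] (∀ bs → ∂ {n} g bs ≈ᴹ f bs)

  CohomNonzero : ℕ → Set (m ⊔ ℓm)
  CohomNonzero n = ∃[ f ] (IsBCocycle {n} f × ¬ IsBCoboundary {n} f)

{-# OPTIONS --safe #-}

-- Upper bound.  Filter a 𝕜B-module V by the submodules killed by ideals of B that grow by one support e at a time.
-- On a subquotient, b acts as the identity if e ∙ b ≡ e and as zero otherwise; there a bar cochain (b₁, …, bₙ) can be
-- replaced, up to an explicit prism homotopy, by its value on the partial products e b₁ > e b₁ b₂ > …, that is, by
-- a cochain on chains of ∂ eB.  Chain cochains form a complex of finitely generated free 𝕜-modules, so vanishing
-- of its cohomology with coefficients 𝕜 from some degree on yields a contracting homotopy there (descending
-- induction on the degree, constructively up to double negation), whose matrix works for every coefficient module.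
--
-- Lower bound.  For V = 𝕜 with the above action of B, pulling chain cochains back along (b₁, …, bₙ) ↦ (e b₁, e b₁ b₂, …)
-- is injective on cohomology, because a descending chain, read as a bar word, has itself as its partial products.
module Submission where

open import Defs
open import Level using (Level; _⊔_; lift)
open import Data.Nat using (ℕ; zero; suc; _≤_; _<_; _≤?_; s≤s; z≤n) renaming (_+_ to _+ℕ_)
import Data.Nat.Properties as ℕ
open import Data.Fin as Fin using (Fin; zero; suc; toℕ)
import Data.Fin.Properties as Fin
open import Data.List as List using (List)
open import Data.List.Membership.Propositional using (_∈_)
open import Data.List.Membership.Propositional.Properties using (∈-tabulate⁺)
open import Data.List.Relation.Unary.Any using (here; there)
open import Data.Product using (Σ; ∃-syntax; _×_; _,_; proj₁; proj₂)
open import Data.Sum using (_⊎_; inj₁; inj₂; map₂)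
open import Data.Unit using (⊤; tt)
open import Data.Vec using (Vec; []; _∷_; _∷ʳ_; map; allFin; lookup; reverse; init; removeAt)
open import Data.Vec.N-ary using (N-ary; curryⁿ; _$ⁿ_; Eq; curryⁿ-cong)
open import Data.Vec.Properties using (reverse-∷; reverse-involutive; ≡-dec; ∷-injectiveˡ; ∷-injectiveʳ)
open import Function using (_∘_; Inverse)
open import Function.Properties.Inverse using (↔⇒↣)
open import Relation.Nullary using (¬_; Dec; yes; no; contradiction; ¬?; _×-dec_)
open import Relation.Nullary.Decidable using (via-injection)
open import Relation.Nullary.Negation using (¬¬-map)
open import Relation.Binary.Definitions using (DecidableEquality)
open import Relation.Binary.PropositionalEquality as ≡ using (_≡_; refl; cong; subst)
open import Algebra.Bundles using (AbelianGroup; CommutativeRing)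
open import Algebra.Definitions using (Associative)
open import Algebra.Module.Bundles using (LeftModule)
import Algebra.Module.Construct.TensorUnit as TensorUnit
import Algebra.Properties.CommutativeSemigroup as CommutativeSemigroupProperties
import Algebra.Properties.Group as GroupProperties
import Algebra.Solver.CommutativeMonoid.Normal as CommutativeMonoidNormal
open import Algebra.Structures using (module IsMonoid)
import Relation.Binary.Reasoning.Setoid as SetoidReasoning

-- Solving equations in abelian groups

-- Subtractions are moved across the equation, which leaves an identity for the commutative monoid solver.
module AbelianGroupSolver {c ℓ} (G : AbelianGroup c ℓ) where
  open AbelianGroup G hiding (refl)
  open SetoidReasoning setoid
  open CommutativeSemigroupProperties commutativeSemigroup using (interchange)
  private module CM = CommutativeMonoidNormal commutativeMonoid

  infixl 6 _:+_ _:-_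
  infix  4 _:=_

  data Expr (n : ℕ) : Set where
    var       : Fin n → Expr n
    :0        : Expr n
    _:+_ _:-_ : Expr n → Expr n → Expr n

  _:=_ : ∀ {n} → Expr n → Expr n → Expr n × Expr n
  _:=_ = _,_

  ⟦_⟧ : ∀ {n} → Expr n → Vec Carrier n → Carrier
  ⟦ var i ⟧  ρ = CM.⟦ CM.var i ⟧ ρ
  ⟦ :0 ⟧     ρ = ε
  ⟦ s :+ t ⟧ ρ = ⟦ s ⟧ ρ ∙ ⟦ t ⟧ ρ
  ⟦ s :- t ⟧ ρ = ⟦ s ⟧ ρ ∙ ⟦ t ⟧ ρ ⁻¹

  pos neg : ∀ {n} → Expr n → CM.Expr n
  pos (var i)  = CM.var i
  pos :0       = CM.id
  pos (s :+ t) = pos s CM.⊕ pos t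
  pos (s :- t) = pos s CM.⊕ neg t
  neg (var i)  = CM.id
  neg :0       = CM.id
  neg (s :+ t) = neg s CM.⊕ neg t
  neg (s :- t) = neg s CM.⊕ pos t

  balance : ∀ {n} (t : Expr n) ρ → ⟦ t ⟧ ρ ∙ CM.⟦ neg t ⟧ ρ ≈ CM.⟦ pos t ⟧ ρ
  balance (var i)  ρ = identityʳ _
  balance :0       ρ = identityʳ _
  balance (s :+ t) ρ = begin
    (⟦ s ⟧ ρ ∙ ⟦ t ⟧ ρ) ∙ (CM.⟦ neg s ⟧ ρ ∙ CM.⟦ neg t ⟧ ρ)  ≈⟨ interchange _ _ _ _ ⟩
    (⟦ s ⟧ ρ ∙ CM.⟦ neg s ⟧ ρ) ∙ (⟦ t ⟧ ρ ∙ CM.⟦ neg t ⟧ ρ)  ≈⟨ ∙-cong (balance s ρ) (balance t ρ) ⟩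
    CM.⟦ pos s ⟧ ρ ∙ CM.⟦ pos t ⟧ ρ                          ∎
  balance (s :- t) ρ = begin
    (⟦ s ⟧ ρ ∙ ⟦ t ⟧ ρ ⁻¹) ∙ (CM.⟦ neg s ⟧ ρ ∙ CM.⟦ pos t ⟧ ρ)                 ≈⟨ interchange _ _ _ _ ⟩
    (⟦ s ⟧ ρ ∙ CM.⟦ neg s ⟧ ρ) ∙ (⟦ t ⟧ ρ ⁻¹ ∙ CM.⟦ pos t ⟧ ρ)                 ≈⟨ ∙-cong (balance s ρ) (∙-congˡ (sym (balance t ρ))) ⟩
    CM.⟦ pos s ⟧ ρ ∙ (⟦ t ⟧ ρ ⁻¹ ∙ (⟦ t ⟧ ρ ∙ CM.⟦ neg t ⟧ ρ))                 ≈⟨ ∙-congˡ (sym (assoc _ _ _)) ⟩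
    CM.⟦ pos s ⟧ ρ ∙ (⟦ t ⟧ ρ ⁻¹ ∙ ⟦ t ⟧ ρ ∙ CM.⟦ neg t ⟧ ρ)                   ≈⟨ ∙-congˡ (∙-congʳ (inverseˡ _)) ⟩
    CM.⟦ pos s ⟧ ρ ∙ (ε ∙ CM.⟦ neg t ⟧ ρ)                                      ≈⟨ ∙-congˡ (identityˡ _) ⟩
    CM.⟦ pos s ⟧ ρ ∙ CM.⟦ neg t ⟧ ρ                                            ∎

  prove : ∀ {n} (s t : Expr n) → CM.normalise (pos s CM.⊕ neg t) ≡ CM.normalise (pos t CM.⊕ neg s) →
          ∀ ρ → ⟦ s ⟧ ρ ≈ ⟦ t ⟧ ρ
  prove s t eq ρ = GroupProperties.∙-cancelʳ group (CM.⟦ neg s ⟧ ρ ∙ CM.⟦ neg t ⟧ ρ) _ _ (begin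
    ⟦ s ⟧ ρ ∙ (CM.⟦ neg s ⟧ ρ ∙ CM.⟦ neg t ⟧ ρ)  ≈⟨ assoc _ _ _ ⟨
    ⟦ s ⟧ ρ ∙ CM.⟦ neg s ⟧ ρ ∙ CM.⟦ neg t ⟧ ρ    ≈⟨ ∙-congʳ (balance s ρ) ⟩
    CM.⟦ pos s CM.⊕ neg t ⟧ ρ                    ≈⟨ CM.correct (pos s CM.⊕ neg t) ρ ⟨
    CM.⟦ CM.normalise (pos s CM.⊕ neg t) ⟧⇓ ρ    ≡⟨ cong (λ v → CM.⟦ v ⟧⇓ ρ) eq ⟩
    CM.⟦ CM.normalise (pos t CM.⊕ neg s) ⟧⇓ ρ    ≈⟨ CM.correct (pos t CM.⊕ neg s) ρ ⟩
    CM.⟦ pos t CM.⊕ neg s ⟧ ρ                    ≈⟨ ∙-congʳ (balance t ρ) ⟨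
    ⟦ t ⟧ ρ ∙ CM.⟦ neg t ⟧ ρ ∙ CM.⟦ neg s ⟧ ρ    ≈⟨ assoc _ _ _ ⟩
    ⟦ t ⟧ ρ ∙ (CM.⟦ neg t ⟧ ρ ∙ CM.⟦ neg s ⟧ ρ)  ≈⟨ ∙-congˡ (comm _ _) ⟩
    ⟦ t ⟧ ρ ∙ (CM.⟦ neg s ⟧ ρ ∙ CM.⟦ neg t ⟧ ρ)  ∎)

  solve : ∀ n (f : N-ary n (Expr n) (Expr n × Expr n)) →
          let s , t = f $ⁿ map var (allFin n) in
          CM.normalise (pos s CM.⊕ neg t) ≡ CM.normalise (pos t CM.⊕ neg s) →
          Eq n _≈_ (curryⁿ ⟦ s ⟧) (curryⁿ ⟦ t ⟧)
  solve n f eq = curryⁿ-cong _≈_ ⟦ s ⟧ ⟦ t ⟧ (prove s t eq)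
    where s = proj₁ (f $ⁿ map var (allFin n)) ; t = proj₂ (f $ⁿ map var (allFin n))

-- Formal chains and their pairing with cochains

-- Elements of the free abelian group on Vec A n; pre a prepends a to every vector.
data Chain (A : Set) : ℕ → Set where
  pt  : ∀ {n} → Vec A n → Chain A n
  𝟘   : ∀ {n} → Chain A n
  _⊖_ : ∀ {n} → Chain A n → Chain A n → Chain A n
  pre : ∀ {n} → A → Chain A n → Chain A (suc n)

-- A proof of `P` kills the chain: in `products` and `prismTail`, `P` says that a product fails to
-- descend. A condition that should keep the chain enters as `¬?`.
guard : ∀ {p} {P : Set p} {A n} → Dec P → Chain A n → Chain A n
guard (yes _) t = 𝟘
guard (no  _) t = t

-- The bar differential without its first term: f (b ∙ b₁, …) − f (b, b₁ ∙ b₂, …) + ….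
merges : ∀ {A n} → (A → A → A) → A → Vec A n → Chain A n
merges _·_ b []       = pt []
merges _·_ b (c ∷ bs) = pt ((b · c) ∷ bs) ⊖ pre b (merges _·_ c bs)

-- Merging with the right projection deletes an entry.
faces : ∀ {A n} → Vec A (suc n) → Chain A n
faces (x ∷ xs) = merges (λ _ y → y) x xs

record Additive {c ℓ c′ ℓ′} (G : AbelianGroup c ℓ) (H : AbelianGroup c′ ℓ′)
                (α : AbelianGroup.Carrier G → AbelianGroup.Carrier H) : Set (c ⊔ ℓ ⊔ ℓ′) where
  private
    module G = AbelianGroup G
    module H = AbelianGroup H
  field
    α-cong : ∀ {x y} → x G.≈ y → α x H.≈ α y
    α-+    : ∀ x y → α (x G.∙ y) H.≈ α x H.∙ α y

  α-0 : α G.ε H.≈ H.ε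
  α-0 = GroupProperties.identityʳ-unique H.group (α G.ε) (α G.ε)
          (H.trans (H.sym (α-+ G.ε G.ε)) (α-cong (G.identityʳ G.ε)))

  α-neg : ∀ x → α (x G.⁻¹) H.≈ α x H.⁻¹
  α-neg x = GroupProperties.inverseˡ-unique H.group (α (x G.⁻¹)) (α x)
              (H.trans (H.sym (α-+ (x G.⁻¹) x)) (H.trans (α-cong (G.inverseˡ x)) α-0))

  α-sub : ∀ x y → α (x G.∙ y G.⁻¹) H.≈ α x H.∙ α y H.⁻¹
  α-sub x y = H.trans (α-+ x (y G.⁻¹)) (H.∙-congˡ (α-neg y))

module Pairing {c ℓ} (G : AbelianGroup c ℓ) where
  open AbelianGroup G using (_≈_; setoid; ∙-cong; ⁻¹-cong; reflexive)
    renaming (Carrier to ∣G∣; _∙_ to _+_; ε to 0#; _⁻¹ to -_; refl to ≈-refl; trans to ≈-trans)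
  open AbelianGroupSolver G using (solve; _:+_; _:-_; _:=_; :0)
  open SetoidReasoning setoid

  private variable
    A : Set
    n : ℕ

  infixl 6 _-_
  _-_ : ∣G∣ → ∣G∣ → ∣G∣
  x - y = x + - y

  sub-cong : ∀ {x x′ y y′} → x ≈ x′ → y ≈ y′ → x - y ≈ x′ - y′
  sub-cong p q = ∙-cong p (⁻¹-cong q)

  -- The linear extension of a cochain. Formal chains do not mention the group, so the same chain
  -- can be evaluated over `𝕜` and over any module.
  ⟨_,_⟩ : Chain A n → (Vec A n → ∣G∣) → ∣G∣
  ⟨ pt v , f ⟩    = f v
  ⟨ 𝟘 , f ⟩       = 0#
  ⟨ s ⊖ t , f ⟩   = ⟨ s , f ⟩ - ⟨ t , f ⟩
  ⟨ pre a t , f ⟩ = ⟨ t , (λ v → f (a ∷ v)) ⟩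

  ⟨⟩-cong : (t : Chain A n) {f g : Vec A n → ∣G∣} → (∀ v → f v ≈ g v) → ⟨ t , f ⟩ ≈ ⟨ t , g ⟩
  ⟨⟩-cong (pt v)    eq = eq v
  ⟨⟩-cong 𝟘         eq = ≈-refl
  ⟨⟩-cong (s ⊖ t)   eq = sub-cong (⟨⟩-cong s eq) (⟨⟩-cong t eq)
  ⟨⟩-cong (pre a t) eq = ⟨⟩-cong t (λ v → eq (a ∷ v))

  ⟨⟩-sub : (t : Chain A n) (f g : Vec A n → ∣G∣) → ⟨ t , (λ v → f v - g v) ⟩ ≈ ⟨ t , f ⟩ - ⟨ t , g ⟩
  ⟨⟩-sub (pt v)    f g = ≈-refl
  ⟨⟩-sub 𝟘         f g = solve 0 (:0 := :0 :- :0) refl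
  ⟨⟩-sub (s ⊖ t)   f g = ≈-trans (sub-cong (⟨⟩-sub s f g) (⟨⟩-sub t f g))
    (solve 4 (λ a b c d → (a :- b) :- (c :- d) := (a :- c) :- (b :- d)) refl _ _ _ _)
  ⟨⟩-sub (pre a t) f g = ⟨⟩-sub t _ _

  ⟨⟩-+ : (t : Chain A n) (f g : Vec A n → ∣G∣) → ⟨ t , (λ v → f v + g v) ⟩ ≈ ⟨ t , f ⟩ + ⟨ t , g ⟩
  ⟨⟩-+ (pt v)    f g = ≈-refl
  ⟨⟩-+ 𝟘         f g = solve 0 (:0 := :0 :+ :0) refl
  ⟨⟩-+ (s ⊖ t)   f g = ≈-trans (sub-cong (⟨⟩-+ s f g) (⟨⟩-+ t f g))
    (solve 4 (λ a b c d → (a :+ b) :- (c :+ d) := (a :- c) :+ (b :- d)) refl _ _ _ _)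
  ⟨⟩-+ (pre a t) f g = ⟨⟩-+ t _ _

  ⟨⟩-0 : (t : Chain A n) {f : Vec A n → ∣G∣} → (∀ v → f v ≈ 0#) → ⟨ t , f ⟩ ≈ 0#
  ⟨⟩-0 (pt v)    eq = eq v
  ⟨⟩-0 𝟘         eq = ≈-refl
  ⟨⟩-0 (s ⊖ t)   eq = ≈-trans (sub-cong (⟨⟩-0 s eq) (⟨⟩-0 t eq)) (solve 0 (:0 :- :0 := :0) refl)
  ⟨⟩-0 (pre a t) eq = ⟨⟩-0 t (λ v → eq (a ∷ v))

  guard-yes : ∀ {p} {P : Set p} (P? : Dec P) → P → (t : Chain A n) {f : Vec A n → ∣G∣} → ⟨ guard P? t , f ⟩ ≈ 0#
  guard-yes (yes _) p t = ≈-refl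
  guard-yes (no ¬p) p t = contradiction p ¬p

  guard-no : ∀ {p} {P : Set p} (P? : Dec P) → ¬ P → (t : Chain A n) {f : Vec A n → ∣G∣} → ⟨ guard P? t , f ⟩ ≈ ⟨ t , f ⟩
  guard-no (yes p) ¬p t = contradiction p ¬p
  guard-no (no _)  ¬p t = ≈-refl

  -- The identity behind the vanishing of squared differentials: the terms that keep `a` as first
  -- entry cancel (the two copies of `t`). The right projection gives `faces-faces`, the product of
  -- `B` gives `∂∂≈0`.
  merges-merges : {_·_ : A → A → A} → Associative _≡_ _·_ → ∀ a b (bs : Vec A n) (f : Vec A n → ∣G∣) →
    ⟨ merges _·_ b bs , (λ v → ⟨ merges _·_ a v , f ⟩) ⟩ ≈ ⟨ merges _·_ (a · b) bs , f ⟩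
  merges-merges assoc a b []       f = ≈-refl
  merges-merges {_·_ = _·_} assoc a b (c ∷ cs) f = begin
    (f ((a · (b · c)) ∷ cs) - t) - ⟨ merges _·_ c cs , (λ v → f ((a · b) ∷ v) - ⟨ merges _·_ b v , (λ w → f (a ∷ w)) ⟩) ⟩
      ≈⟨ sub-cong (sub-cong (reflexive (cong (λ x → f (x ∷ cs)) (≡.sym (assoc a b c)))) (≈-refl {t}))
                  (≈-trans (⟨⟩-sub (merges _·_ c cs) _ _) (sub-cong (≈-refl {u}) (merges-merges assoc b c cs _))) ⟩
    (f (((a · b) · c) ∷ cs) - t) - (u - t)
      ≈⟨ solve 3 (λ f t u → (f :- t) :- (u :- t) := f :- u) refl _ t u ⟩
    f (((a · b) · c) ∷ cs) - u ∎
    where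
    t = ⟨ merges _·_ (b · c) cs , (λ w → f (a ∷ w)) ⟩
    u = ⟨ merges _·_ c cs , (λ v → f ((a · b) ∷ v)) ⟩

  faces-faces : ∀ (xs : Vec A (suc (suc n))) (f : Vec A n → ∣G∣) → ⟨ faces xs , (λ v → ⟨ faces v , f ⟩) ⟩ ≈ 0#
  faces-faces (x ∷ y ∷ ys) f = ≈-trans (sub-cong ≈-refl (merges-merges (λ _ _ _ → refl) x y ys f))
    (solve 1 (λ a → a :- a := :0) refl _)

module _ {c ℓ c′ ℓ′} {G : AbelianGroup c ℓ} {H : AbelianGroup c′ ℓ′}
         {α : AbelianGroup.Carrier G → AbelianGroup.Carrier H} (additive : Additive G H α) where
  open Additive additive
  private
    module G = Pairing G
    module H = Pairing H
  open AbelianGroup H renaming (refl to ≈-refl)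

  -- Serves for three kinds of maps: signs, multiplication by or of scalars, and the action of an
  -- element of `B`.
  pairing-additive : ∀ {A n} (t : Chain A n) (f : Vec A n → AbelianGroup.Carrier G) → α G.⟨ t , f ⟩ ≈ H.⟨ t , α ∘ f ⟩
  pairing-additive (pt v)    f = ≈-refl
  pairing-additive 𝟘         f = α-0
  pairing-additive (s ⊖ t)   f = trans (α-sub _ _) (H.sub-cong (pairing-additive s f) (pairing-additive t f))
  pairing-additive (pre a t) f = pairing-additive t (λ v → f (a ∷ v))

-- Descending chains in B and the prism homotopy

module LRB (B : FiniteLRBMonoid) where
  open FiniteLRBMonoid B public
  open IsMonoid isMonoid public using (assoc; identityˡ; identityʳ)

  infix 4 _≟_
  _≟_ : DecidableEquality Carrier
  _≟_ = via-injection (↔⇒↣ enum) Fin._≟_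

  ∙-absorbs : ∀ a b → a ∙ (a ∙ b) ≡ a ∙ b
  ∙-absorbs a b = ≡.trans (≡.sym (assoc a a b)) (cong (_∙ b) (idem a))

  -- Once a product has moved away from `a` it never returns: `ab = aba = ab(abc) = abc = a`. This
  -- makes the cut-off in `products` and `prism` compatible with merging and the rank-one action
  -- multiplicative.
  a∙b∙c≡a⇒a∙b≡a : ∀ a b c → a ∙ (b ∙ c) ≡ a → a ∙ b ≡ a
  a∙b∙c≡a⇒a∙b≡a a b c abc≡a = begin
    a ∙ b                ≡⟨ lrb a b ⟨
    a ∙ b ∙ a            ≡⟨ cong (a ∙ b ∙_) (≡.trans (≡.sym abc≡a) (≡.sym (assoc a b c))) ⟩
    a ∙ b ∙ (a ∙ b ∙ c)  ≡⟨ ∙-absorbs (a ∙ b) c ⟩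
    a ∙ b ∙ c            ≡⟨ assoc a b c ⟩
    a ∙ (b ∙ c)          ≡⟨ abc≡a ⟩
    a                    ∎
    where open ≡.≡-Reasoning

  ≤B-trans : ∀ {a b c} → a ≤B b → b ≤B c → a ≤B c
  ≤B-trans {a} {b} {c} ba≡a cb≡b = begin
    c ∙ a        ≡⟨ cong (c ∙_) ba≡a ⟨
    c ∙ (b ∙ a)  ≡⟨ assoc c b a ⟨
    c ∙ b ∙ a    ≡⟨ cong (_∙ a) cb≡b ⟩
    b ∙ a        ≡⟨ ba≡a ⟩
    a            ∎
    where open ≡.≡-Reasoning

  ≤B-antisym : ∀ {a b} → a ≤B b → b ≤B a → a ≡ b
  ≤B-antisym {a} {b} ba≡a ab≡b = begin
    a          ≡⟨ ba≡a ⟨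
    b ∙ a      ≡⟨ cong (_∙ a) ab≡b ⟨
    a ∙ b ∙ a  ≡⟨ lrb a b ⟩
    a ∙ b      ≡⟨ ab≡b ⟩
    b          ∎
    where open ≡.≡-Reasoning

  <B-trans : ∀ {a b c} → a <B b → b <B c → a <B c
  <B-trans (a≤b , a≢b) (b≤c , b≢c) =
    ≤B-trans a≤b b≤c , λ { refl → a≢b (≤B-antisym a≤b b≤c) }

  -- Listed from the top down, against the order of `IsChain`, because the partial products of a bar
  -- word appear in this order. `reverse` translates between the two.
  Descending : Carrier → ∀ {n} → Vec Carrier n → Set
  Descending x []       = ⊤
  Descending x (y ∷ ys) = y <B x × Descending y ys

  Descending-weaken : ∀ {x y n} (ys : Vec Carrier n) → y <B x → Descending y ys → Descending x ys
  Descending-weaken []       y<x _           = tt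
  Descending-weaken (z ∷ zs) y<x (z<y , dzs) = <B-trans z<y y<x , dzs

  -- The chain of partial products of a bar word; words with a repeated product are degenerate and
  -- count as zero.
  products : ∀ {n} → Carrier → Vec Carrier n → Chain Carrier n
  products x []       = pt []
  products x (b ∷ bs) = guard (x ∙ b ≟ x) (pre (x ∙ b) (products (x ∙ b) bs))

  mutual
    -- The homotopy between products and the identity.  With xᵢ = x ∙ b₁ ∙ … ∙ bᵢ it is
    -- (x, b₁, b₂, …) − (x₁, x₁, b₂, …) + (x₁, x₂, x₂, b₃, …) − …, cut off at the first i with xᵢ₊₁ = xᵢ.
    prism : ∀ {n} → Carrier → Vec Carrier n → Chain Carrier (suc n)
    prism x bs = pt (x ∷ bs) ⊖ prismTail x bs

    prismTail : ∀ {n} → Carrier → Vec Carrier n → Chain Carrier (suc n)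
    prismTail x []       = 𝟘
    prismTail x (b ∷ bs) = guard (x ∙ b ≟ x) (pre (x ∙ b) (prism (x ∙ b) bs))

module Homotopy (B : FiniteLRBMonoid) {c ℓ} (G : AbelianGroup c ℓ) where
  open LRB B renaming (Carrier to ∣B∣)
  open Pairing G
  open AbelianGroup G using (_≈_; setoid; ∙-cong; ∙-congˡ; reflexive)
    renaming (Carrier to ∣G∣; _∙_ to _+_; ε to 0#; refl to ≈-refl; sym to ≈-sym; trans to ≈-trans)
  open AbelianGroupSolver G using (solve; _:+_; _:-_; _:=_; :0)
  open SetoidReasoning setoid

  private variable
    n : ℕ

  products-cong : ∀ x (bs : Vec ∣B∣ n) {f g : Vec ∣B∣ n → ∣G∣} →
    (∀ v → Descending x v → f v ≈ g v) → ⟨ products x bs , f ⟩ ≈ ⟨ products x bs , g ⟩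
  products-cong x []       eq = eq [] tt
  products-cong x (b ∷ bs) eq with x ∙ b ≟ x
  ... | yes _   = ≈-refl
  ... | no xb≢x = products-cong (x ∙ b) bs (λ v dv → eq _ ((∙-absorbs x b , xb≢x) , dv))

  products-pt : ∀ x (v : Vec ∣B∣ n) → Descending x v → (f : Vec ∣B∣ n → ∣G∣) → ⟨ products x v , f ⟩ ≈ f v
  products-pt x []      _                    f = ≈-refl
  products-pt x (y ∷ v) ((xy≡y , y≢x) , dv) f with x ∙ y ≟ x
  ... | yes xy≡x = contradiction (≡.trans (≡.sym xy≡y) xy≡x) y≢x
  ... | no _ rewrite xy≡y = products-pt y v dv _

  -- Below `y` one has `yz = z`, so merging two neighbours deletes the larger one.
  merges-Descending : ∀ x y (v : Vec ∣B∣ n) → Descending x (y ∷ v) → (f : Vec ∣B∣ n → ∣G∣) →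
    ⟨ merges _∙_ y v , f ⟩ ≈ ⟨ faces (y ∷ v) , f ⟩
  merges-Descending x y []      _                          f = ≈-refl
  merges-Descending x y (z ∷ v) (_ , dzv@((yz≡z , _) , _)) f =
    sub-cong (reflexive (cong (λ w → f (w ∷ v)) yz≡z)) (merges-Descending y z v dzv _)

  faces-cong : ∀ x (v : Vec ∣B∣ (suc n)) → Descending x v → {f g : Vec ∣B∣ n → ∣G∣} →
    (∀ w → Descending x w → f w ≈ g w) → ⟨ faces v , f ⟩ ≈ ⟨ faces v , g ⟩
  faces-cong x (y ∷ [])     (y<x , _)          eq = eq [] tt
  faces-cong x (y ∷ z ∷ zs) (y<x , dzs) eq =
    sub-cong (eq (z ∷ zs) (Descending-weaken (z ∷ zs) y<x dzs))
             (faces-cong y (z ∷ zs) dzs (λ w dw → eq (y ∷ w) (y<x , dw)))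

  -- Pulling back along `products` commutes with the differentials up to sign. Here `u` is the
  -- leading bar term, known only through the rank-one behaviour of `b`: pullback if `b` fixes `x`,
  -- zero otherwise. Leaving `u` abstract lets the recursion and both bounds use the same statement.
  products-faces : ∀ x b (bs : Vec ∣B∣ n) (φ : Vec ∣B∣ n → ∣G∣) u →
    (x ∙ b ≡ x → u ≈ ⟨ products x bs , φ ⟩) → (¬ x ∙ b ≡ x → u ≈ 0#) →
    u - ⟨ merges _∙_ b bs , (λ v → ⟨ products x v , φ ⟩) ⟩
      ≈ 0# - ⟨ products x (b ∷ bs) , (λ v → ⟨ faces v , φ ⟩) ⟩
  products-faces x b bs φ u fix move = split (x ∙ b ≟ x)
    where
    y = x ∙ b

    split : Dec (y ≡ x) → u - ⟨ merges _∙_ b bs , (λ v → ⟨ products x v , φ ⟩) ⟩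
                           ≈ 0# - ⟨ products x (b ∷ bs) , (λ v → ⟨ faces v , φ ⟩) ⟩
    split (yes xb≡x) = ≈-trans (sub-cong (fix xb≡x) (merged bs φ))
      (≈-trans (solve 1 (λ a → a :- a := :0 :- :0) refl _)
               (sub-cong ≈-refl (≈-sym (guard-yes (x ∙ b ≟ x) xb≡x (pre y (products y bs))))))
      where
      -- Merging `b` into its neighbour changes nothing, as `x(bb′) = xb′`; every other term keeps
      -- `b` in front and is killed by `guard`.
      merged : ∀ {n} (bs : Vec ∣B∣ n) φ → ⟨ merges _∙_ b bs , (λ v → ⟨ products x v , φ ⟩) ⟩ ≈ ⟨ products x bs , φ ⟩
      merged []        φ = ≈-refl
      merged (b′ ∷ bs) φ = begin
        ⟨ products x (b ∙ b′ ∷ bs) , φ ⟩ - ⟨ merges _∙_ b′ bs , (λ v → ⟨ products x (b ∷ v) , φ ⟩) ⟩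
          ≈⟨ sub-cong (reflexive (cong (λ z → ⟨ guard (z ≟ x) (pre z (products z bs)) , φ ⟩) x[bb′]≡xb′))
                      (⟨⟩-0 (merges _∙_ b′ bs) (λ v → guard-yes (x ∙ b ≟ x) xb≡x (pre y (products y v)))) ⟩
        ⟨ products x (b′ ∷ bs) , φ ⟩ - 0#
          ≈⟨ solve 1 (λ a → a :- :0 := a) refl _ ⟩
        ⟨ products x (b′ ∷ bs) , φ ⟩ ∎
        where x[bb′]≡xb′ = ≡.trans (≡.sym (assoc x b b′)) (cong (_∙ b′) xb≡x)
    split (no xb≢x) = sub-cong (move xb≢x) (begin
      ⟨ merges _∙_ b bs , (λ v → ⟨ products x v , φ ⟩) ⟩   ≈⟨ shifted bs φ ⟩
      ⟨ products y bs , (λ v → ⟨ faces (y ∷ v) , φ ⟩) ⟩    ≈⟨ guard-no (x ∙ b ≟ x) xb≢x (pre y (products y bs)) ⟨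
      ⟨ products x (b ∷ bs) , (λ v → ⟨ faces v , φ ⟩) ⟩    ∎)
      where
      shifted : ∀ {n} (bs : Vec ∣B∣ n) φ → ⟨ merges _∙_ b bs , (λ v → ⟨ products x v , φ ⟩) ⟩
                                            ≈ ⟨ products y bs , (λ v → ⟨ faces (y ∷ v) , φ ⟩) ⟩
      shifted []        φ = ≈-refl
      shifted (b′ ∷ bs) φ = begin
        s - ⟨ merges _∙_ b′ bs , (λ v → ⟨ products x (b ∷ v) , φ ⟩) ⟩
          ≈⟨ sub-cong ≈-refl (⟨⟩-cong (merges _∙_ b′ bs) (λ v → guard-no (x ∙ b ≟ x) xb≢x (pre y (products y v)))) ⟩
        s - q
          ≈⟨ solve 3 (λ s t q → s :- q := t :+ ((s :- t) :- q)) refl s t q ⟩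
        t + ((s - t) - q)
          -- At `y` the difference `s - t` takes the place of `u`: if `b′` fixes `y` then `t`
          -- vanishes, and otherwise `s` and `t` agree.
          ≈⟨ ∙-congˡ (products-faces y b′ bs (λ v → φ (y ∷ v)) (s - t) fix′ move′) ⟩
        t + (0# - ⟨ products y (b′ ∷ bs) , (λ v → ⟨ faces v , (λ w → φ (y ∷ w)) ⟩) ⟩)
          ≈⟨ solve 2 (λ t p → t :+ (:0 :- p) := t :- p) refl _ _ ⟩
        t - ⟨ products y (b′ ∷ bs) , (λ v → ⟨ faces v , (λ w → φ (y ∷ w)) ⟩) ⟩
          ≈⟨ ⟨⟩-sub (products y (b′ ∷ bs)) _ _ ⟨
        ⟨ products y (b′ ∷ bs) , (λ v → φ v - ⟨ faces v , (λ w → φ (y ∷ w)) ⟩) ⟩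
          ≈⟨ ⟨⟩-cong (products y (b′ ∷ bs)) (λ { (_ ∷ _) → ≈-refl }) ⟩
        ⟨ products y (b′ ∷ bs) , (λ v → ⟨ faces (y ∷ v) , φ ⟩) ⟩ ∎
        where
        s = ⟨ products x (b ∙ b′ ∷ bs) , φ ⟩
        t = ⟨ products y (b′ ∷ bs) , φ ⟩
        q = ⟨ merges _∙_ b′ bs , (λ v → ⟨ products y v , (λ w → φ (y ∷ w)) ⟩) ⟩
        z = x ∙ (b ∙ b′)
        z≢x : ¬ z ≡ x
        z≢x eq = xb≢x (a∙b∙c≡a⇒a∙b≡a x b b′ eq)
        s≈ : s ≈ ⟨ products (y ∙ b′) bs , (λ v → φ (y ∙ b′ ∷ v)) ⟩
        s≈ = ≈-trans (guard-no (z ≟ x) z≢x (pre z (products z bs)))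
               (reflexive (cong (λ w → ⟨ pre w (products w bs) , φ ⟩) (≡.sym (assoc x b b′))))
        fix′ : y ∙ b′ ≡ y → s - t ≈ ⟨ products y bs , (λ w → φ (y ∷ w)) ⟩
        fix′ eq = ≈-trans (sub-cong (≈-trans s≈ (reflexive (cong (λ w → ⟨ pre w (products w bs) , φ ⟩) eq)))
                                    (guard-yes (y ∙ b′ ≟ y) eq (pre (y ∙ b′) (products (y ∙ b′) bs))))
                          (solve 1 (λ a → a :- :0 := a) refl _)
        move′ : ¬ y ∙ b′ ≡ y → s - t ≈ 0#
        move′ neq = ≈-trans (sub-cong s≈ (guard-no (y ∙ b′ ≟ y) neq (pre (y ∙ b′) (products (y ∙ b′) bs))))
                            (solve 1 (λ a → a :- a := :0) refl _)

  -- For `F x v = x ▷ f v` this is `x ▷ ∂ f`, by `▷-∂`. The homotopy is proved for arbitrary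
  -- families, since its recursion passes to an `F′` that need not come from an action.
  d : (∣B∣ → Vec ∣B∣ n → ∣G∣) → ∣B∣ → Vec ∣B∣ (suc n) → ∣G∣
  d F x (b ∷ bs) = F (x ∙ b) bs - ⟨ merges _∙_ b bs , F x ⟩

  -- The formula `∂h + h∂ = id - p`, with `h` the pairing with `prism` and `p` the pairing with
  -- `products`. The leading term of the outer differential appears as the move of the base point
  -- from `x` to `x ∙ b`.
  prism-homotopy : ∀ (F : ∣B∣ → Vec ∣B∣ (suc n) → ∣G∣) x b bs →
    (⟨ prism (x ∙ b) bs , F (x ∙ b) ⟩ - ⟨ merges _∙_ b bs , (λ v → ⟨ prism x v , F x ⟩) ⟩) + ⟨ prism x (b ∷ bs) , d F x ⟩
      ≈ F x (b ∷ bs) - ⟨ products x (b ∷ bs) , F x ⟩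
  prism-homotopy F x b bs = begin
    (P F bs - ⟨ merges _∙_ b bs , (λ v → ⟨ prism x v , F x ⟩) ⟩) + ((F (x ∙ x) (b ∷ bs) - (F x (y ∷ bs) - m)) - t F bs)
      ≈⟨ ∙-cong (sub-cong ≈-refl (⟨⟩-sub (merges _∙_ b bs) _ _))
                (sub-cong (sub-cong (reflexive (cong (λ z → F z (b ∷ bs)) (idem x))) ≈-refl) ≈-refl) ⟩
    (P F bs - (m - k F bs)) + ((F x (b ∷ bs) - (F x (y ∷ bs) - m)) - t F bs)
      ≈⟨ solve 6 (λ P m k f g t → (P :- (m :- k)) :+ ((f :- (g :- m)) :- t) := f :+ (((P :+ k) :- g) :- t)) refl _ _ _ _ _ _ ⟩
    F x (b ∷ bs) + (((P F bs + k F bs) - F x (y ∷ bs)) - t F bs)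
      ≈⟨ ∙-congˡ (core (y ≟ x) F bs) ⟩
    F x (b ∷ bs) + (0# - ⟨ products x (b ∷ bs) , F x ⟩)
      ≈⟨ solve 2 (λ f p → f :+ (:0 :- p) := f :- p) refl _ _ ⟩
    F x (b ∷ bs) - ⟨ products x (b ∷ bs) , F x ⟩ ∎
    where
    y = x ∙ b
    m = ⟨ merges _∙_ b bs , (λ v → F x (x ∷ v)) ⟩

    P k t : ∀ {n} → (∣B∣ → Vec ∣B∣ (suc n) → ∣G∣) → Vec ∣B∣ n → ∣G∣
    P F bs = ⟨ prism y bs , F y ⟩
    k F bs = ⟨ merges _∙_ b bs , (λ v → ⟨ prismTail x v , F x ⟩) ⟩
    t F bs = ⟨ prismTail x (b ∷ bs) , d F x ⟩

    core : ∀ {n} → Dec (y ≡ x) → (F : ∣B∣ → Vec ∣B∣ (suc n) → ∣G∣) (bs : Vec ∣B∣ n) →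
      ((P F bs + k F bs) - F x (y ∷ bs)) - t F bs ≈ 0# - ⟨ products x (b ∷ bs) , F x ⟩
    core (yes y≡x) F bs = begin
      ((P F bs + k F bs) - F x (y ∷ bs)) - t F bs
        ≈⟨ sub-cong (sub-cong (∙-cong (reflexive (cong (λ z → ⟨ prism z bs , F z ⟩) y≡x)) (merged bs (F x)))
                              (reflexive (cong (λ z → F x (z ∷ bs)) y≡x)))
                    (guard-yes (y ≟ x) y≡x (pre y (prism y bs))) ⟩
      (((F x (x ∷ bs) - ⟨ prismTail x bs , F x ⟩) + ⟨ prismTail x bs , F x ⟩) - F x (x ∷ bs)) - 0#
        ≈⟨ solve 2 (λ f k → (((f :- k) :+ k) :- f) :- :0 := :0 :- :0) refl _ _ ⟩
      0# - 0#
        ≈⟨ sub-cong ≈-refl (guard-yes (y ≟ x) y≡x (pre y (products y bs))) ⟨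
      0# - ⟨ products x (b ∷ bs) , F x ⟩ ∎
      where
      merged : ∀ {n} (bs : Vec ∣B∣ n) f → ⟨ merges _∙_ b bs , (λ v → ⟨ prismTail x v , f ⟩) ⟩ ≈ ⟨ prismTail x bs , f ⟩
      merged []        f = ≈-refl
      merged (b′ ∷ bs) f = begin
        ⟨ prismTail x (b ∙ b′ ∷ bs) , f ⟩ - ⟨ merges _∙_ b′ bs , (λ v → ⟨ prismTail x (b ∷ v) , f ⟩) ⟩
          ≈⟨ sub-cong (reflexive (cong (λ z → ⟨ guard (z ≟ x) (pre z (prism z bs)) , f ⟩) x[bb′]≡xb′))
                      (⟨⟩-0 (merges _∙_ b′ bs) (λ v → guard-yes (y ≟ x) y≡x (pre y (prism y v)))) ⟩
        ⟨ prismTail x (b′ ∷ bs) , f ⟩ - 0#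
          ≈⟨ solve 1 (λ a → a :- :0 := a) refl _ ⟩
        ⟨ prismTail x (b′ ∷ bs) , f ⟩ ∎
        where x[bb′]≡xb′ = ≡.trans (≡.sym (assoc x b b′)) (cong (_∙ b′) y≡x)
    core (no y≢x) F bs = begin
      ((P F bs + k F bs) - F x (y ∷ bs)) - t F bs
        ≈⟨ sub-cong ≈-refl (≈-trans (guard-no (y ≟ x) y≢x (pre y (prism y bs))) t≈) ⟩
      ((P F bs + k F bs) - F x (y ∷ bs)) - (P F bs - r F bs)
        ≈⟨ solve 4 (λ P k f r → ((P :+ k) :- f) :- (P :- r) := (k :+ r) :- f) refl _ _ _ _ ⟩
      (k F bs + r F bs) - F x (y ∷ bs)
        ≈⟨ sub-cong (k+r F bs) ≈-refl ⟩
      (F x (y ∷ bs) - ⟨ products y bs , (λ v → F x (y ∷ v)) ⟩) - F x (y ∷ bs)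
        ≈⟨ solve 2 (λ f p → (f :- p) :- f := :0 :- p) refl _ _ ⟩
      0# - ⟨ products y bs , (λ v → F x (y ∷ v)) ⟩
        ≈⟨ sub-cong ≈-refl (guard-no (y ≟ x) y≢x (pre y (products y bs))) ⟨
      0# - ⟨ products x (b ∷ bs) , F x ⟩ ∎
      where
      r : ∀ {n} → (∣B∣ → Vec ∣B∣ (suc n) → ∣G∣) → Vec ∣B∣ n → ∣G∣
      r F bs = ⟨ prism y bs , (λ v → ⟨ merges _∙_ y v , F x ⟩) ⟩

      t≈ : ⟨ prism y bs , (λ v → d F x (y ∷ v)) ⟩ ≈ P F bs - r F bs
      t≈ = ≈-trans (⟨⟩-cong (prism y bs) (λ v → sub-cong (reflexive (cong (λ z → F z v) (∙-absorbs x b))) ≈-refl))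
                   (⟨⟩-sub (prism y bs) _ _)

      -- With the vertex `y` kept in front, the sum is the left side of the homotopy formula for
      -- `F′` at `y`, because `d F′ y` is merging with `y`. This closes the induction.
      k+r : ∀ {n} (F : ∣B∣ → Vec ∣B∣ (suc n) → ∣G∣) (bs : Vec ∣B∣ n) →
        k F bs + r F bs ≈ F x (y ∷ bs) - ⟨ products y bs , (λ v → F x (y ∷ v)) ⟩
      k+r F [] = begin
        0# + ((F x (y ∙ y ∷ []) - F x (y ∷ [])) - 0#)
          ≈⟨ ∙-congˡ (sub-cong (sub-cong (reflexive (cong (λ z → F x (z ∷ [])) (idem y))) ≈-refl) ≈-refl) ⟩
        0# + ((F x (y ∷ []) - F x (y ∷ [])) - 0#)
          ≈⟨ solve 1 (λ f → :0 :+ ((f :- f) :- :0) := f :- f) refl _ ⟩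
        F x (y ∷ []) - F x (y ∷ []) ∎
      k+r F (b′ ∷ bs) = begin
        k F (b′ ∷ bs) + r F (b′ ∷ bs)
          ≈⟨ ∙-cong (sub-cong k₁ (⟨⟩-cong (merges _∙_ b′ bs) (λ v → guard-no (y ≟ x) y≢x (pre y (prism y v)))))
                    (⟨⟩-cong (prism y (b′ ∷ bs)) (λ { (_ ∷ _) → ≈-refl })) ⟩
        (⟨ prism (y ∙ b′) bs , F′ (y ∙ b′) ⟩ - ⟨ merges _∙_ b′ bs , (λ v → ⟨ prism y v , F′ y ⟩) ⟩)
          + ⟨ prism y (b′ ∷ bs) , d F′ y ⟩
          ≈⟨ prism-homotopy F′ y b′ bs ⟩
        F′ y (b′ ∷ bs) - ⟨ products y (b′ ∷ bs) , F′ y ⟩ ∎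
        where
        F′ : ∣B∣ → Vec ∣B∣ _ → ∣G∣
        F′ z v = F x (z ∷ v)
        z = x ∙ (b ∙ b′)
        k₁ : ⟨ prismTail x (b ∙ b′ ∷ bs) , F x ⟩ ≈ ⟨ prism (y ∙ b′) bs , F′ (y ∙ b′) ⟩
        k₁ = ≈-trans (guard-no (z ≟ x) (λ eq → y≢x (a∙b∙c≡a⇒a∙b≡a x b b′ eq)) (pre z (prism z bs)))
               (reflexive (cong (λ w → ⟨ pre w (prism w bs) , F x ⟩) (≡.sym (assoc x b b′))))

-- Comparison with the simplicial and bar differentials

module Signs {c ℓ} (G : AbelianGroup c ℓ) where
  open Pairing G
  open AbelianGroup G using (_≈_; setoid; ∙-cong; ∙-congˡ; ⁻¹-cong; reflexive)
    renaming (Carrier to ∣G∣; _∙_ to _+_; ε to 0#; _⁻¹ to -_; refl to ≈-refl; sym to ≈-sym; trans to ≈-trans)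
  open AbelianGroupSolver G using (solve; _:+_; _:-_; _:=_; :0)
  open SetoidReasoning setoid

  neg≈0- : ∀ x → - x ≈ 0# - x
  neg≈0- x = ≈-sym (AbelianGroup.identityˡ G (- x))

  fsum-neg : ∀ {n} (f : Fin n → ∣G∣) → fsum _+_ 0# (λ i → - f i) ≈ 0# - fsum _+_ 0# f
  fsum-neg {zero}  f = solve 0 (:0 := :0 :- :0) refl
  fsum-neg {suc n} f = begin
    - f zero + fsum _+_ 0# (λ i → - f (suc i))           ≈⟨ ∙-cong (neg≈0- _) (fsum-neg (λ i → f (suc i))) ⟩
    (0# - f zero) + (0# - fsum _+_ 0# (λ i → f (suc i)))  ≈⟨ solve 2 (λ a b → (:0 :- a) :+ (:0 :- b) := :0 :- (a :+ b)) refl _ _ ⟩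
    0# - fsum _+_ 0# f                                     ∎

  signed-additive : ∀ n → Additive G G (signed -_ n)
  signed-additive zero    = record { α-cong = λ eq → eq ; α-+ = λ _ _ → ≈-refl }
  signed-additive (suc n) = record
    { α-cong = λ eq → ⁻¹-cong (α-cong eq)
    ; α-+    = λ x y → begin
        - signed -_ n (x + y)                          ≈⟨ ⁻¹-cong (α-+ x y) ⟩
        - (signed -_ n x + signed -_ n y)              ≈⟨ neg≈0- _ ⟩
        0# - (signed -_ n x + signed -_ n y)           ≈⟨ solve 2 (λ a b → :0 :- (a :+ b) := (:0 :- a) :+ (:0 :- b)) refl _ _ ⟩
        (0# - signed -_ n x) + (0# - signed -_ n y)    ≈⟨ ∙-cong (neg≈0- _) (neg≈0- _) ⟨
        - signed -_ n x + - signed -_ n y              ∎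
    }
    where open Additive (signed-additive n)

  signed-involutive : ∀ n x → signed -_ n (signed -_ n x) ≈ x
  signed-involutive zero    x = ≈-refl
  signed-involutive (suc n) x = begin
    - signed -_ n (- signed -_ n x)         ≈⟨ ⁻¹-cong (Additive.α-neg (signed-additive n) _) ⟩
    - - signed -_ n (signed -_ n x)         ≈⟨ ⁻¹-cong (⁻¹-cong (signed-involutive n x)) ⟩
    - - x                                   ≈⟨ ≈-trans (neg≈0- _) (sub-cong ≈-refl (neg≈0- x)) ⟩
    0# - (0# - x)                           ≈⟨ solve 1 (λ x → :0 :- (:0 :- x) := x) refl x ⟩
    x                                       ∎

  module _ {A : Set} where

    alternating-faces : ∀ {n} (xs : Vec A (suc n)) (φ : Vec A n → ∣G∣) →
      fsum _+_ 0# (λ i → signed -_ (toℕ i) (φ (removeAt xs i))) ≈ ⟨ faces xs , φ ⟩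
    alternating-faces (x ∷ [])     φ = solve 1 (λ a → a :+ :0 := a) refl _
    alternating-faces (x ∷ y ∷ ys) φ = ∙-congˡ (begin
      fsum _+_ 0# (λ i → - signed -_ (toℕ i) (φ (x ∷ removeAt (y ∷ ys) i)))
        ≈⟨ fsum-neg (λ i → signed -_ (toℕ i) (φ (x ∷ removeAt (y ∷ ys) i))) ⟩
      0# - fsum _+_ 0# (λ i → signed -_ (toℕ i) (φ (x ∷ removeAt (y ∷ ys) i)))
        ≈⟨ sub-cong ≈-refl (alternating-faces (y ∷ ys) (λ v → φ (x ∷ v))) ⟩
      0# - ⟨ faces (y ∷ ys) , (λ v → φ (x ∷ v)) ⟩
        ≈⟨ neg≈0- _ ⟨
      - ⟨ faces (y ∷ ys) , (λ v → φ (x ∷ v)) ⟩ ∎)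

    faces-∷ʳ : ∀ {n} (xs : Vec A (suc n)) x (φ : Vec A (suc n) → ∣G∣) →
      ⟨ faces (xs ∷ʳ x) , φ ⟩ ≈ ⟨ faces xs , (λ v → φ (v ∷ʳ x)) ⟩ + signed -_ (suc n) (φ xs)
    faces-∷ʳ (y ∷ [])      x φ = ≈-refl
    faces-∷ʳ {suc n} (y ∷ z ∷ zs) x φ = begin
      φ (z ∷ (zs ∷ʳ x)) - ⟨ faces (z ∷ (zs ∷ʳ x)) , (λ v → φ (y ∷ v)) ⟩
        ≈⟨ sub-cong ≈-refl (faces-∷ʳ (z ∷ zs) x (λ v → φ (y ∷ v))) ⟩
      φ (z ∷ (zs ∷ʳ x)) - (⟨ faces (z ∷ zs) , (λ v → φ (y ∷ (v ∷ʳ x))) ⟩ + s)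
        ≈⟨ solve 3 (λ f g s → f :- (g :+ s) := (f :- g) :+ (:0 :- s)) refl _ _ s ⟩
      (φ (z ∷ (zs ∷ʳ x)) - ⟨ faces (z ∷ zs) , (λ v → φ (y ∷ (v ∷ʳ x))) ⟩) + (0# - s)
        ≈⟨ ∙-congˡ (neg≈0- s) ⟨
      (φ (z ∷ (zs ∷ʳ x)) - ⟨ faces (z ∷ zs) , (λ v → φ (y ∷ (v ∷ʳ x))) ⟩) + (- s) ∎
      where s = signed -_ (suc n) (φ (y ∷ z ∷ zs))

    -- Reversal exchanges the faces `i` and `n - i`, so the alternating sums differ by the global
    -- sign `(-1)^n`.
    faces-reverse : ∀ {n} (xs : Vec A (suc n)) (φ : Vec A n → ∣G∣) →
      ⟨ faces xs , φ ∘ reverse ⟩ ≈ signed -_ n ⟨ faces (reverse xs) , φ ⟩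
    faces-reverse (x ∷ [])              φ = ≈-refl
    faces-reverse {suc n} (x ∷ ys@(_ ∷ _)) φ = begin
      φ (reverse ys) - ⟨ faces ys , (λ v → φ (reverse (x ∷ v))) ⟩
        ≈⟨ sub-cong ≈-refl (⟨⟩-cong (faces ys) (λ v → reflexive (cong φ (reverse-∷ x v)))) ⟩
      φ (reverse ys) - ⟨ faces ys , (λ v → φ (v ∷ʳ x)) ∘ reverse ⟩
        ≈⟨ sub-cong ≈-refl (faces-reverse ys (λ v → φ (v ∷ʳ x))) ⟩
      φ (reverse ys) - signed -_ n A′
        ≈⟨ solve 2 (λ a b → a :- b := :0 :- (b :+ (:0 :- a))) refl _ _ ⟩
      0# - (signed -_ n A′ + (0# - φ (reverse ys)))
        -- The lone term is replaced by its double `signed`, so that one sign can be pulled out of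
        -- the whole sum.
        ≈⟨ sub-cong ≈-refl (∙-congˡ (≈-trans (sub-cong ≈-refl (≈-sym (signed-involutive n _))) (≈-sym (neg≈0- _)))) ⟩
      0# - (signed -_ n A′ + - signed -_ n (signed -_ n (φ (reverse ys))))
        ≈⟨ sub-cong ≈-refl (∙-congˡ (α-neg _)) ⟨
      0# - (signed -_ n A′ + signed -_ n (- signed -_ n (φ (reverse ys))))
        ≈⟨ sub-cong ≈-refl (α-+ _ _) ⟨
      0# - signed -_ n (A′ + - signed -_ n (φ (reverse ys)))
        ≈⟨ neg≈0- _ ⟨
      - signed -_ n (A′ + signed -_ (suc n) (φ (reverse ys)))
        ≈⟨ ⁻¹-cong (α-cong (faces-∷ʳ (reverse ys) x φ)) ⟨
      - signed -_ n ⟨ faces (reverse ys ∷ʳ x) , φ ⟩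
        ≡⟨ cong (λ v → - signed -_ n ⟨ faces v , φ ⟩) (reverse-∷ x ys) ⟨
      - signed -_ n ⟨ faces (reverse (x ∷ ys)) , φ ⟩ ∎
      where
      open Additive (signed-additive n)
      A′ = ⟨ faces (reverse ys) , (λ v → φ (v ∷ʳ x)) ⟩

module ChainReversal (B : FiniteLRBMonoid) where
  open LRB B

  In∂⇒<B : ∀ {e x} → In∂ e x → x <B e
  In∂⇒<B {e} ((b , eb≡x) , x≢e) =
    ≡.trans (cong (e ∙_) (≡.sym eb≡x)) (≡.trans (∙-absorbs e b) eb≡x) , x≢e

  <B⇒In∂ : ∀ {e x} → x <B e → In∂ e x
  <B⇒In∂ {x = x} (ex≡x , x≢e) = (x , ex≡x) , x≢e

  IsChain-∷ʳ : ∀ {e x n} (ys : Vec Carrier n) → x <B e → IsChain x ys → IsChain e (ys ∷ʳ x)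
  IsChain-∷ʳ []           x<e _                      = <B⇒In∂ x<e
  IsChain-∷ʳ (y ∷ [])     x<e y∈∂x                   =
    <B⇒In∂ (<B-trans (In∂⇒<B y∈∂x) x<e) , In∂⇒<B y∈∂x , <B⇒In∂ x<e
  IsChain-∷ʳ (y ∷ z ∷ zs) x<e (y∈∂x , y<z , chain) =
    <B⇒In∂ (<B-trans (In∂⇒<B y∈∂x) x<e) , y<z , IsChain-∷ʳ (z ∷ zs) x<e chain

  Descending⇒IsChain : ∀ {e n} (xs : Vec Carrier n) → Descending e xs → IsChain e (reverse xs)
  Descending⇒IsChain         []       _           = tt
  Descending⇒IsChain {e} (x ∷ xs) (x<e , dxs) =
    subst (IsChain e) (≡.sym (reverse-∷ x xs)) (IsChain-∷ʳ (reverse xs) x<e (Descending⇒IsChain xs dxs))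

  Descending-∷ʳ : ∀ {e y x n} (ys : Vec Carrier n) → Descending e (ys ∷ʳ y) → x <B y → Descending e (ys ∷ʳ y ∷ʳ x)
  Descending-∷ʳ []       (y<e , _)  x<y = y<e , x<y , tt
  Descending-∷ʳ (z ∷ zs) (z<e , ds) x<y = z<e , Descending-∷ʳ zs ds x<y

  IsChain⇒Descending : ∀ {e n} (xs : Vec Carrier n) → IsChain e xs → Descending e (reverse xs)
  IsChain⇒Descending     []           _                   = tt
  IsChain⇒Descending     (x ∷ [])     x∈∂e                = In∂⇒<B x∈∂e , tt
  IsChain⇒Descending {e} (x ∷ y ∷ ys) (_ , x<y , chain) =
    subst (Descending e) (≡.sym (≡.trans (reverse-∷ x (y ∷ ys)) (cong (_∷ʳ x) (reverse-∷ y ys))))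
      (Descending-∷ʳ (reverse ys) (subst (Descending e) (reverse-∷ y ys) (IsChain⇒Descending (y ∷ ys) chain)) x<y)

module DescendingCochains {c ℓ} (𝕜 : CommutativeRing c ℓ) (B : FiniteLRBMonoid) where
  open CommutativeRing 𝕜 using (_≈_; 0#; -_; setoid; +-abelianGroup) renaming (sym to ≈-sym; trans to ≈-trans)
  open ReducedCohomology 𝕜 B
  open ChainReversal B
  open LRB B using (Descending) renaming (Carrier to ∣B∣)
  open Pairing +-abelianGroup
  open Signs +-abelianGroup
  open SetoidReasoning setoid

  IsCocycle⇒Descending : ∀ {e n} (φ : Cochain n) → IsCocycle e φ →
    ∀ v → Descending e v → ⟨ faces v , φ ∘ reverse ⟩ ≈ 0#
  IsCocycle⇒Descending {n = n} φ cocycle v dv = begin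
    ⟨ faces v , φ ∘ reverse ⟩           ≈⟨ faces-reverse v φ ⟩
    signed -_ n ⟨ faces (reverse v) , φ ⟩  ≈⟨ α-cong (≈-trans (≈-sym (alternating-faces (reverse v) φ)) (cocycle (reverse v) (Descending⇒IsChain v dv))) ⟩
    signed -_ n 0#                      ≈⟨ α-0 ⟩
    0#                                  ∎
    where open Additive (signed-additive n)

  Descending⇒IsCocycle : ∀ {e n} (φ : Cochain n) → (∀ v → Descending e v → ⟨ faces v , φ ⟩ ≈ 0#) →
    IsCocycle e (φ ∘ reverse)
  Descending⇒IsCocycle {n = n} φ cocycle v chain = begin
    δ (φ ∘ reverse) v                   ≈⟨ alternating-faces v (φ ∘ reverse) ⟩
    ⟨ faces v , φ ∘ reverse ⟩           ≈⟨ faces-reverse v φ ⟩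
    signed -_ n ⟨ faces (reverse v) , φ ⟩  ≈⟨ α-cong (cocycle (reverse v) (IsChain⇒Descending v chain)) ⟩
    signed -_ n 0#                      ≈⟨ α-0 ⟩
    0#                                  ∎
    where open Additive (signed-additive n)

  -- The extra sign cancels that of `faces-reverse`, so primitives can be carried through `reverse`
  -- in either direction.
  faces-signed-reverse : ∀ {n} (v : Vec ∣B∣ (suc n)) (ψ : Cochain n) →
    ⟨ faces v , signed -_ n ∘ ψ ∘ reverse ⟩ ≈ ⟨ faces (reverse v) , ψ ⟩
  faces-signed-reverse {n} v ψ = begin
    ⟨ faces v , signed -_ n ∘ ψ ∘ reverse ⟩               ≈⟨ pairing-additive (signed-additive n) (faces v) (ψ ∘ reverse) ⟨
    signed -_ n ⟨ faces v , ψ ∘ reverse ⟩                 ≈⟨ Additive.α-cong (signed-additive n) (faces-reverse v ψ) ⟩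
    signed -_ n (signed -_ n ⟨ faces (reverse v) , ψ ⟩)   ≈⟨ signed-involutive n _ ⟩
    ⟨ faces (reverse v) , ψ ⟩                             ∎

  IsCoboundary⇒Descending : ∀ {e n} (φ : Cochain (suc n)) → IsCoboundary e φ →
    ∃[ ψ ] (∀ v → Descending e v → ⟨ faces v , ψ ⟩ ≈ φ (reverse v))
  IsCoboundary⇒Descending {n = n} φ (ψ , δψ≈φ) = signed -_ n ∘ ψ ∘ reverse , λ v dv →
    ≈-trans (faces-signed-reverse v ψ)
      (≈-trans (≈-sym (alternating-faces (reverse v) ψ)) (δψ≈φ (reverse v) (Descending⇒IsChain v dv)))

  Descending⇒IsCoboundary : ∀ {e n} (φ : Cochain (suc n)) (ψ : Cochain n) →
    (∀ v → Descending e v → ⟨ faces v , ψ ⟩ ≈ φ (reverse v)) → IsCoboundary e φ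
  Descending⇒IsCoboundary {n = n} φ ψ eq = signed -_ n ∘ ψ ∘ reverse , λ v chain → begin
    δ (signed -_ n ∘ ψ ∘ reverse) v          ≈⟨ alternating-faces v (signed -_ n ∘ ψ ∘ reverse) ⟩
    ⟨ faces v , signed -_ n ∘ ψ ∘ reverse ⟩  ≈⟨ faces-signed-reverse v ψ ⟩
    ⟨ faces (reverse v) , ψ ⟩                ≈⟨ eq (reverse v) (IsChain⇒Descending v chain) ⟩
    φ (reverse (reverse v))                  ≡⟨ cong φ (reverse-involutive v) ⟩
    φ v                                      ∎

module BarDifferential {c ℓ m ℓm} {𝕜 : CommutativeRing c ℓ} {B : FiniteLRBMonoid} (V : KBModule 𝕜 B m ℓm) where
  open KBModule V
  open LeftModule kmodule
  open MonoidCohomology V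
  open LRB B using (_∙_) renaming (Carrier to ∣B∣)
  open Pairing +ᴹ-abelianGroup
  open Signs +ᴹ-abelianGroup
  open SetoidReasoning ≈ᴹ-setoid
  open AbelianGroupSolver +ᴹ-abelianGroup using (solve; _:+_; _:-_; _:=_; :0)

  alternating-merges : ∀ {n} b (bs : Vec ∣B∣ n) (f : BCochain n) →
    fsum _+ᴹ_ 0ᴹ (λ i → signed -ᴹ_ (toℕ i) (f (mergeAt i (b ∷ bs)))) +ᴹ signed -ᴹ_ n (f (init (b ∷ bs)))
      ≈ᴹ ⟨ merges _∙_ b bs , f ⟩
  alternating-merges b []       f = solve 1 (λ a → :0 :+ a := a) refl _
  alternating-merges {suc n} b (c ∷ cs) f = begin
    (f (b ∙ c ∷ cs) +ᴹ fsum _+ᴹ_ 0ᴹ (λ i → -ᴹ s i)) +ᴹ -ᴹ u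
      ≈⟨ +ᴹ-cong (+ᴹ-cong ≈ᴹ-refl (fsum-neg s)) (neg≈0- u) ⟩
    (f (b ∙ c ∷ cs) +ᴹ (0ᴹ - fsum _+ᴹ_ 0ᴹ s)) +ᴹ (0ᴹ - u)
      ≈⟨ solve 3 (λ f s u → (f :+ (:0 :- s)) :+ (:0 :- u) := f :- (s :+ u)) refl _ _ _ ⟩
    f (b ∙ c ∷ cs) - (fsum _+ᴹ_ 0ᴹ s +ᴹ u)
      ≈⟨ sub-cong ≈ᴹ-refl (alternating-merges c cs (λ v → f (b ∷ v))) ⟩
    f (b ∙ c ∷ cs) - ⟨ merges _∙_ c cs , (λ v → f (b ∷ v)) ⟩ ∎
    where
    s : Fin _ → Carrierᴹ
    s i = signed -ᴹ_ (toℕ i) (f (b ∷ mergeAt i (c ∷ cs)))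
    u = signed -ᴹ_ n (f (b ∷ init (c ∷ cs)))

  -- Puts the differential into the recursive form in which all later computations treat it; the
  -- deletion of the last entry is the base case of `merges`.
  ∂-merges : ∀ {n} (f : BCochain n) b bs → ∂ f (b ∷ bs) ≈ᴹ (b ▷ f bs) - ⟨ merges _∙_ b bs , f ⟩
  ∂-merges {n} f b bs = +ᴹ-cong ≈ᴹ-refl (begin
    fsum _+ᴹ_ 0ᴹ (λ i → -ᴹ s i) +ᴹ -ᴹ u          ≈⟨ +ᴹ-cong (fsum-neg s) (neg≈0- u) ⟩
    (0ᴹ - fsum _+ᴹ_ 0ᴹ s) +ᴹ (0ᴹ - u)             ≈⟨ solve 2 (λ s u → (:0 :- s) :+ (:0 :- u) := :0 :- (s :+ u)) refl _ _ ⟩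
    0ᴹ - (fsum _+ᴹ_ 0ᴹ s +ᴹ u)                    ≈⟨ sub-cong ≈ᴹ-refl (alternating-merges b bs f) ⟩
    0ᴹ - ⟨ merges _∙_ b bs , f ⟩                  ≈⟨ neg≈0- _ ⟨
    -ᴹ ⟨ merges _∙_ b bs , f ⟩                    ∎)
    where
    s : Fin _ → Carrierᴹ
    s i = signed -ᴹ_ (toℕ i) (f (mergeAt i (b ∷ bs)))
    u = signed -ᴹ_ n (f (init (b ∷ bs)))

-- The rank-one modules

module RankOneModule {c ℓ} (𝕜 : CommutativeRing c ℓ) (B : FiniteLRBMonoid) (e : FiniteLRBMonoid.Carrier B) where
  open CommutativeRing 𝕜 using (_≈_; _+_; _*_; 0#; -_; ring; setoid; +-abelianGroup; +-identityˡ; zeroʳ)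
    renaming (Carrier to K; refl to ≈-refl; sym to ≈-sym; trans to ≈-trans; reflexive to ≈-reflexive)
  open LRB B renaming (Carrier to ∣B∣)
  open ReducedCohomology 𝕜 B
  open DescendingCochains 𝕜 B
  open Homotopy B +-abelianGroup using (products-cong; products-pt; products-faces; merges-Descending)
  open Pairing +-abelianGroup
  open SetoidReasoning setoid

  act : ∀ {p} {P : Set p} → Dec P → K → K
  act (yes _) v = v
  act (no  _) v = 0#

  act-yes : ∀ {p} {P : Set p} (P? : Dec P) → P → ∀ v → act P? v ≈ v
  act-yes (yes _) p v = ≈-refl
  act-yes (no ¬p) p v = contradiction p ¬p

  act-no : ∀ {p} {P : Set p} (P? : Dec P) → ¬ P → ∀ v → act P? v ≈ 0#
  act-no (yes p) ¬p v = contradiction p ¬p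
  act-no (no _)  ¬p v = ≈-refl

  act-cong : ∀ {p} {P : Set p} (P? : Dec P) {v w} → v ≈ w → act P? v ≈ act P? w
  act-cong (yes _) eq = eq
  act-cong (no _)  eq = ≈-refl

  act-+ : ∀ {p} {P : Set p} (P? : Dec P) v w → act P? (v + w) ≈ act P? v + act P? w
  act-+ (yes _) v w = ≈-refl
  act-+ (no _)  v w = ≈-sym (+-identityˡ 0#)

  act-* : ∀ {p} {P : Set p} (P? : Dec P) r v → act P? (r * v) ≈ r * act P? v
  act-* (yes _) r v = ≈-refl
  act-* (no _)  r v = ≈-sym (zeroʳ r)

  act-assoc : ∀ a b v → act (e ∙ (a ∙ b) ≟ e) v ≈ act (e ∙ a ≟ e) (act (e ∙ b ≟ e) v)
  act-assoc a b v with e ∙ a ≟ e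
  ... | yes ea≡e = ≈-reflexive (cong (λ z → act (z ≟ e) v) (≡.trans (≡.sym (assoc e a b)) (cong (_∙ b) ea≡e)))
  ... | no  ea≢e = act-no (e ∙ (a ∙ b) ≟ e) (λ eab≡e → ea≢e (a∙b∙c≡a⇒a∙b≡a e a b eab≡e)) v

  -- The module 𝕜 with b acting as the identity if Be ⊆ Bb and as zero otherwise; Be ⊆ Bb means e ∙ b ≡ e.
  rankOne : KBModule 𝕜 B c ℓ
  rankOne = record
    { kmodule = TensorUnit.leftModule {R = ring}
    ; _▷_     = λ b → act (e ∙ b ≟ e)
    ; ▷-cong  = λ b → act-cong (e ∙ b ≟ e)
    ; ▷-ε     = act-yes (e ∙ ε ≟ e) (identityʳ e)
    ; ▷-assoc = act-assoc
    ; ▷-+     = λ b → act-+ (e ∙ b ≟ e)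
    ; ▷-*ₗ    = λ b → act-* (e ∙ b ≟ e)
    }

  open MonoidCohomology rankOne using (IsBCocycle; IsBCoboundary; CohomNonzero)
  open BarDifferential rankOne using (∂-merges)
  open AbelianGroupSolver +-abelianGroup using (solve; _:-_; _:=_; :0)

  fromChains : ∀ {n} → Cochain n → Vec ∣B∣ n → K
  fromChains φ bs = ⟨ products e bs , φ ∘ reverse ⟩

  fromChains-cocycle : ∀ {n} (φ : Cochain n) → IsCocycle e φ → IsBCocycle (fromChains φ)
  fromChains-cocycle φ cocycle (b ∷ bs) = begin
    MonoidCohomology.∂ rankOne (fromChains φ) (b ∷ bs)
      ≈⟨ ∂-merges (fromChains φ) b bs ⟩
    act (e ∙ b ≟ e) (fromChains φ bs) - ⟨ merges _∙_ b bs , fromChains φ ⟩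
      ≈⟨ products-faces e b bs (φ ∘ reverse) _ (λ eq → act-yes (e ∙ b ≟ e) eq _) (λ neq → act-no (e ∙ b ≟ e) neq _) ⟩
    0# - ⟨ products e (b ∷ bs) , (λ v → ⟨ faces v , φ ∘ reverse ⟩) ⟩
      ≈⟨ sub-cong ≈-refl (≈-trans (products-cong e (b ∷ bs) (IsCocycle⇒Descending φ cocycle)) (⟨⟩-0 (products e (b ∷ bs)) (λ _ → ≈-refl))) ⟩
    0# - 0#
      ≈⟨ solve 0 (:0 :- :0 := :0) refl ⟩
    0# ∎

  -- A primitive `g` is restricted to descending words. There the first entry `x` satisfies
  -- `ex = x ≠ e` and acts as zero, so only minus the simplicial differential of `g` is left; hence
  -- the primitive `0# - g v`.
  fromChains-coboundary : ∀ {n} (φ : Cochain n) → IsBCoboundary (fromChains φ) → IsCoboundary e φ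
  fromChains-coboundary {zero}  φ (lift eq)   = lift (eq [])
  fromChains-coboundary {suc n} φ (g , ∂g≈f) = Descending⇒IsCoboundary φ (λ v → 0# - g v) bounds
    where
    bounds : ∀ v → Descending e v → ⟨ faces v , (λ w → 0# - g w) ⟩ ≈ φ (reverse v)
    bounds v@(x ∷ xs) dv@((ex≡x , x≢e) , _) = begin
      ⟨ faces v , (λ w → 0# - g w) ⟩
        ≈⟨ ⟨⟩-sub (faces v) (λ _ → 0#) g ⟩
      ⟨ faces v , (λ _ → 0#) ⟩ - ⟨ faces v , g ⟩
        ≈⟨ sub-cong (≈-trans (⟨⟩-0 (faces v) (λ _ → ≈-refl)) (≈-sym (act-no (e ∙ x ≟ e) (λ ex≡e → x≢e (≡.trans (≡.sym ex≡x) ex≡e)) (g xs))))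
                    (≈-sym (merges-Descending e x xs dv g)) ⟩
      act (e ∙ x ≟ e) (g xs) - ⟨ merges _∙_ x xs , g ⟩
        ≈⟨ ∂-merges g x xs ⟨
      MonoidCohomology.∂ rankOne g v
        ≈⟨ ∂g≈f v ⟩
      ⟨ products e v , φ ∘ reverse ⟩
        ≈⟨ products-pt e v dv (φ ∘ reverse) ⟩
      φ (reverse v) ∎

  ReducedNonzero⇒CohomNonzero : ∀ {n} → ReducedNonzero e n → CohomNonzero n
  ReducedNonzero⇒CohomNonzero (φ , cocycle , ¬coboundary) =
    fromChains φ , fromChains-cocycle φ cocycle , ¬coboundary ∘ fromChains-coboundary φ

-- Contractions with arbitrary coefficients

-- `Chain` has only differences, so `s + t` is encoded as `s ⊖ (𝟘 ⊖ t)`.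
⨁ : ∀ {A m n} → (Fin m → Chain A n) → Chain A n
⨁ {m = zero}  t = 𝟘
⨁ {m = suc m} t = t zero ⊖ (𝟘 ⊖ ⨁ (λ i → t (suc i)))

module PairingSums {c ℓ} (G : AbelianGroup c ℓ) where
  open Pairing G
  open AbelianGroup G using (_≈_)
    renaming (Carrier to ∣G∣; ε to 0#; refl to ≈-refl; trans to ≈-trans)
  open AbelianGroupSolver G using (solve; _:-_; _:=_; :0)

  ⨁-cong : ∀ {A m n} (t : Fin m → Chain A n) {f g : Vec A n → ∣G∣} →
    (∀ i → ⟨ t i , f ⟩ ≈ ⟨ t i , g ⟩) → ⟨ ⨁ t , f ⟩ ≈ ⟨ ⨁ t , g ⟩
  ⨁-cong {m = zero}  t eq = ≈-refl
  ⨁-cong {m = suc m} t eq = sub-cong (eq zero) (sub-cong ≈-refl (⨁-cong (t ∘ suc) (eq ∘ suc)))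

  ⨁-0 : ∀ {A m n} (t : Fin m → Chain A n) {f : Vec A n → ∣G∣} → (∀ i → ⟨ t i , f ⟩ ≈ 0#) → ⟨ ⨁ t , f ⟩ ≈ 0#
  ⨁-0 {m = zero}  t eq = ≈-refl
  ⨁-0 {m = suc m} t eq = ≈-trans (sub-cong (eq zero) (sub-cong ≈-refl (⨁-0 (t ∘ suc) (eq ∘ suc))))
    (solve 0 (:0 :- (:0 :- :0) := :0) refl)

  ⨁-single : ∀ {A m n} (t : Fin m → Chain A n) {f : Vec A n → ∣G∣} i →
    (∀ j → ¬ j ≡ i → ⟨ t j , f ⟩ ≈ 0#) → ⟨ ⨁ t , f ⟩ ≈ ⟨ t i , f ⟩
  ⨁-single t zero    eq = ≈-trans (sub-cong ≈-refl (sub-cong ≈-refl (⨁-0 (t ∘ suc) (λ j → eq (suc j) (λ ())))))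
    (solve 1 (λ a → a :- (:0 :- :0) := a) refl _)
  ⨁-single t (suc i) eq = ≈-trans (sub-cong (eq zero (λ ())) (sub-cong ≈-refl
      (⨁-single (t ∘ suc) i (λ j j≢i → eq (suc j) (j≢i ∘ Fin.suc-injective)))))
    (solve 1 (λ a → :0 :- (:0 :- a) := a) refl _)

  ⟨⟩-swap : ∀ {A A′ m n} (s : Chain A m) (t : Chain A′ n) (f : Vec A m → Vec A′ n → ∣G∣) →
    ⟨ s , (λ v → ⟨ t , f v ⟩) ⟩ ≈ ⟨ t , (λ w → ⟨ s , (λ v → f v w) ⟩) ⟩
  ⟨⟩-swap s (pt w)    f = ≈-refl
  ⟨⟩-swap s 𝟘         f = ⟨⟩-0 s (λ _ → ≈-refl)
  ⟨⟩-swap s (t ⊖ u)   f = ≈-trans (⟨⟩-sub s _ _) (sub-cong (⟨⟩-swap s t f) (⟨⟩-swap s u f))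
  ⟨⟩-swap s (pre a t) f = ⟨⟩-swap s t (λ v w → f v (a ∷ w))

module Descents (B : FiniteLRBMonoid) where
  open LRB B
  open Inverse enum using (to; from; strictlyInverseˡ; strictlyInverseʳ)

  _<B?_ : ∀ x y → Dec (x <B y)
  x <B? y = (y ∙ x ≟ x) ×-dec ¬? (x ≟ y)

  -- The formal sum of all descending chains of length `n` below `x`. Pairing with it is the finite
  -- sum in a matrix product.
  descents : ∀ n → Carrier → Chain Carrier n
  descents zero    x = pt []
  descents (suc n) x = ⨁ (λ i → guard (¬? (from i <B? x)) (pre (from i) (descents n (from i))))

  Descending-lookup : ∀ {x n} (v : Vec Carrier n) → Descending x v → ∀ i → lookup v i <B x
  Descending-lookup (y ∷ v) (y<x , _)  zero    = y<x
  Descending-lookup (y ∷ v) (y<x , dv) (suc i) = <B-trans (Descending-lookup v dv i) y<x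

  Descending-distinct : ∀ {x n} (v : Vec Carrier n) → Descending x v → ∀ {i j} → i Fin.< j → ¬ lookup v i ≡ lookup v j
  Descending-distinct (y ∷ v) (_ , dv) {zero}  {suc j} i<j       eq = proj₂ (Descending-lookup v dv j) (≡.sym eq)
  Descending-distinct (y ∷ v) (_ , dv) {suc i} {suc j} (s≤s i<j) eq = Descending-distinct v dv i<j eq

  -- The entries are distinct, so the pigeonhole principle applies. The bound starts the descending
  -- induction on degrees and limits the recursion of `extend`.
  Descending-length : ∀ {x n} (v : Vec Carrier n) → Descending x v → ¬ size < n
  Descending-length v dv size<n with Fin.pigeonhole size<n (to ∘ lookup v)
  ... | i , j , i<j , eq = Descending-distinct v dv i<j
    (≡.trans (≡.sym (strictlyInverseʳ _)) (≡.trans (cong from eq) (strictlyInverseʳ _)))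

  -- Finite choice under double negation. It is needed because the absence of nonzero classes yields
  -- primitives only up to double negation.
  ¬¬-Fin : ∀ {p n} {P : Fin n → Set p} → (∀ i → ¬ ¬ P i) → ¬ ¬ (∀ i → P i)
  ¬¬-Fin {n = zero}  f k = k (λ ())
  ¬¬-Fin {n = suc n} f k = f zero (λ p₀ → ¬¬-Fin (f ∘ suc) (λ ps → k (λ { zero → p₀ ; (suc i) → ps i })))

  ¬¬-Carrier : ∀ {p} {P : Carrier → Set p} → (∀ b → ¬ ¬ P b) → ¬ ¬ (∀ b → P b)
  ¬¬-Carrier {P = P} f = ¬¬-map (λ g b → subst P (strictlyInverseʳ b) (g (to b))) (¬¬-Fin (f ∘ from))

  ¬¬-Vec : ∀ {p n} {P : Vec Carrier n → Set p} → (∀ v → ¬ ¬ P v) → ¬ ¬ (∀ v → P v)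
  ¬¬-Vec {n = zero}  f = ¬¬-map (λ p → λ { [] → p }) (f [])
  ¬¬-Vec {n = suc n} f = ¬¬-map (λ g → λ { (b ∷ v) → g b v }) (¬¬-Carrier (λ b → ¬¬-Vec (λ v → f (b ∷ v))))

  module _ {c ℓ} (G : AbelianGroup c ℓ) where
    open Pairing G
    open PairingSums G
    open AbelianGroup G using (_≈_)
      renaming (Carrier to ∣G∣; ε to 0#; refl to ≈-refl; trans to ≈-trans; reflexive to ≈-reflexive)

    descents-cong : ∀ {n} x {f g : Vec Carrier n → ∣G∣} → (∀ v → Descending x v → f v ≈ g v) →
      ⟨ descents n x , f ⟩ ≈ ⟨ descents n x , g ⟩
    descents-cong {zero}  x eq = eq [] tt
    descents-cong {suc n} x {f} {g} eq =
      ⨁-cong (λ i → guard (¬? (from i <B? x)) (pre (from i) (descents n (from i)))) (λ i → term (from i))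
      where
      term : ∀ y → ⟨ guard (¬? (y <B? x)) (pre y (descents n y)) , f ⟩ ≈ ⟨ guard (¬? (y <B? x)) (pre y (descents n y)) , g ⟩
      term y with y <B? x
      ... | yes y<x = descents-cong y (λ v dv → eq (y ∷ v) (y<x , dv))
      ... | no  _   = ≈-refl

    descents-single : ∀ {n} x (v : Vec Carrier n) → Descending x v → {f : Vec Carrier n → ∣G∣} →
      (∀ w → ¬ w ≡ v → f w ≈ 0#) → ⟨ descents n x , f ⟩ ≈ f v
    descents-single {zero}  x []      _          eq = ≈-refl
    descents-single {suc n} x (y ∷ v) (y<x , dv) {f} eq =
      ≈-trans (⨁-single (λ i → term (from i)) (to y) off)
        (≈-trans (≈-reflexive (cong (λ z → ⟨ term z , f ⟩) (strictlyInverseʳ y)))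
          (≈-trans (guard-no (¬? (y <B? x)) (λ y≮x → y≮x y<x) (pre y (descents n y)))
            (descents-single y v dv (λ w w≢v → eq (y ∷ w) (w≢v ∘ ∷-injectiveʳ)))))
      where
      term : Carrier → Chain Carrier (suc n)
      term z = guard (¬? (z <B? x)) (pre z (descents n z))
      off : ∀ i → ¬ i ≡ to y → ⟨ term (from i) , f ⟩ ≈ 0#
      off i i≢y with from i <B? x
      ... | yes _ = ⟨⟩-0 (descents n (from i)) (λ w → eq (from i ∷ w)
              (λ eq → i≢y (≡.trans (≡.sym (strictlyInverseˡ i)) (cong to (∷-injectiveˡ eq)))))
      ... | no  _ = ≈-refl

module Contraction {c ℓ} (𝕜 : CommutativeRing c ℓ) (B : FiniteLRBMonoid) (e : FiniteLRBMonoid.Carrier B) where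
  open CommutativeRing 𝕜 using (ring; _≈_; 0#; 1#; _*_; setoid; +-abelianGroup; zeroʳ; *-congˡ)
    renaming (Carrier to K; refl to ≈-refl; trans to ≈-trans)
  open LRB B renaming (Carrier to ∣B∣)
  open Descents B
  open ReducedCohomology 𝕜 B using (ReducedNonzero)
  open DescendingCochains 𝕜 B
  private module 𝕂 = Pairing +-abelianGroup

  _≟ⱽ_ : ∀ {n} (v w : Vec ∣B∣ n) → Dec (v ≡ w)
  _≟ⱽ_ = ≡-dec _≟_

  indicator : ∀ {p} {P : Set p} → Dec P → K
  indicator (yes _) = 1#
  indicator (no  _) = 0#

  -- The basis cochain at `τ`; with both arguments free, the identity matrix.
  unit : ∀ {n} → Vec ∣B∣ n → Vec ∣B∣ n → K
  unit τ σ = indicator (τ ≟ⱽ σ)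

  -- Matrices of maps h : Cᵐ⁺¹ → Cᵐ and h⁺ : Cᵐ⁺² → Cᵐ⁺¹ between cochains on descending chains, with δ h + h⁺ δ = id.
  record ContractionAt (m : ℕ) : Set (c ⊔ ℓ) where
    field
      h       : Vec ∣B∣ (suc m) → Vec ∣B∣ m → K
      h⁺      : Vec ∣B∣ (suc (suc m)) → Vec ∣B∣ (suc m) → K
      contracts : ∀ τ σ → Descending e σ →
        𝕂.⟨ faces σ , h τ ⟩ ≈ unit τ σ 𝕂.- 𝕂.⟨ descents _ e , (λ τ′ → h⁺ τ′ σ * 𝕂.⟨ faces τ′ , unit τ ⟩) ⟩

  module Coefficients {m ℓm} (N : LeftModule ring m ℓm) where
    open LeftModule N
    open Pairing +ᴹ-abelianGroup
    open PairingSums +ᴹ-abelianGroup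
    open SetoidReasoning ≈ᴹ-setoid

    *ₗ-additive : ∀ r → Additive +ᴹ-abelianGroup +ᴹ-abelianGroup (r *ₗ_)
    *ₗ-additive r = record { α-cong = *ₗ-cong ≈-refl ; α-+ = *ₗ-distribˡ r }

    *ₗ-additiveʳ : ∀ v → Additive +-abelianGroup +ᴹ-abelianGroup (_*ₗ v)
    *ₗ-additiveʳ v = record { α-cong = λ eq → *ₗ-cong eq ≈ᴹ-refl ; α-+ = *ₗ-distribʳ v }

    apply : ∀ {n n′} → (Vec ∣B∣ n → Vec ∣B∣ n′ → K) → (Vec ∣B∣ n → Carrierᴹ) → Vec ∣B∣ n′ → Carrierᴹ
    apply k φ σ = ⟨ descents _ e , (λ τ → k τ σ *ₗ φ τ) ⟩

    apply-unit : ∀ {n} (φ : Vec ∣B∣ n → Carrierᴹ) σ → Descending e σ → apply unit φ σ ≈ᴹ φ σ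
    apply-unit φ σ dσ = ≈ᴹ-trans
      (descents-single +ᴹ-abelianGroup e σ dσ (λ τ τ≢σ → ≈ᴹ-trans (*ₗ-cong (off τ τ≢σ) ≈ᴹ-refl) (*ₗ-zeroˡ (φ τ))))
      (≈ᴹ-trans (*ₗ-cong on ≈ᴹ-refl) (*ₗ-identityˡ (φ σ)))
      where
      off : ∀ τ → ¬ τ ≡ σ → unit τ σ ≈ 0#
      off τ τ≢σ with τ ≟ⱽ σ
      ... | yes τ≡σ = contradiction τ≡σ τ≢σ
      ... | no  _   = ≈-refl
      on : unit σ σ ≈ 1#
      on with σ ≟ⱽ σ
      ... | yes _  = ≈-refl
      ... | no σ≢σ = contradiction refl σ≢σ

    module _ {m} (C : ContractionAt m) where
      open ContractionAt C

      private
        D  = descents (suc m) e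
        D⁺ = descents (suc (suc m)) e

      -- Over `𝕜`, `contracts` is this identity for the basis cochains `unit τ`. Multiplying it by
      -- `φ τ` in `N`, summing over `τ` and exchanging sums gives the general case, which carries
      -- the contraction to every coefficient module.
      faces-apply : ∀ (φ : Vec ∣B∣ (suc m) → Carrierᴹ) σ → Descending e σ →
        ⟨ faces σ , apply h φ ⟩ ≈ᴹ φ σ - apply h⁺ (λ τ′ → ⟨ faces τ′ , φ ⟩) σ
      faces-apply φ σ dσ = begin
        ⟨ faces σ , (λ ρ → ⟨ D , (λ τ → h τ ρ *ₗ φ τ) ⟩) ⟩
          ≈⟨ ⟨⟩-swap (faces σ) D (λ ρ τ → h τ ρ *ₗ φ τ) ⟩
        ⟨ D , (λ τ → ⟨ faces σ , (λ ρ → h τ ρ *ₗ φ τ) ⟩) ⟩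
          ≈⟨ ⟨⟩-cong D step ⟩
        ⟨ D , (λ τ → (unit τ σ *ₗ φ τ) - ⟨ D⁺ , (λ τ′ → h⁺ τ′ σ *ₗ ⟨ faces τ′ , (λ ρ → unit τ ρ *ₗ φ τ) ⟩) ⟩) ⟩
          ≈⟨ ⟨⟩-sub D _ _ ⟩
        apply unit φ σ - ⟨ D , (λ τ → ⟨ D⁺ , (λ τ′ → h⁺ τ′ σ *ₗ ⟨ faces τ′ , (λ ρ → unit τ ρ *ₗ φ τ) ⟩) ⟩) ⟩
          ≈⟨ sub-cong (apply-unit φ σ dσ) (⟨⟩-swap D D⁺ (λ τ τ′ → h⁺ τ′ σ *ₗ ⟨ faces τ′ , (λ ρ → unit τ ρ *ₗ φ τ) ⟩)) ⟩
        φ σ - ⟨ D⁺ , (λ τ′ → ⟨ D , (λ τ → h⁺ τ′ σ *ₗ ⟨ faces τ′ , (λ ρ → unit τ ρ *ₗ φ τ) ⟩) ⟩) ⟩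
          ≈⟨ sub-cong ≈ᴹ-refl (descents-cong +ᴹ-abelianGroup e (λ τ′ dτ′ →
               ≈ᴹ-trans (≈ᴹ-sym (pairing-additive (*ₗ-additive (h⁺ τ′ σ)) D _)) (*ₗ-cong ≈-refl (collapse τ′ dτ′)))) ⟩
        φ σ - apply h⁺ (λ τ′ → ⟨ faces τ′ , φ ⟩) σ ∎
        where
        step : ∀ τ → ⟨ faces σ , (λ ρ → h τ ρ *ₗ φ τ) ⟩
             ≈ᴹ (unit τ σ *ₗ φ τ) - ⟨ D⁺ , (λ τ′ → h⁺ τ′ σ *ₗ ⟨ faces τ′ , (λ ρ → unit τ ρ *ₗ φ τ) ⟩) ⟩
        step τ = begin
          ⟨ faces σ , (λ ρ → h τ ρ *ₗ φ τ) ⟩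
            ≈⟨ pairing-additive (*ₗ-additiveʳ (φ τ)) (faces σ) (h τ) ⟨
          𝕂.⟨ faces σ , h τ ⟩ *ₗ φ τ
            ≈⟨ *ₗ-cong (contracts τ σ dσ) ≈ᴹ-refl ⟩
          (unit τ σ 𝕂.- 𝕂.⟨ D⁺ , (λ τ′ → h⁺ τ′ σ * 𝕂.⟨ faces τ′ , unit τ ⟩) ⟩) *ₗ φ τ
            ≈⟨ Additive.α-sub (*ₗ-additiveʳ (φ τ)) _ _ ⟩
          (unit τ σ *ₗ φ τ) - (𝕂.⟨ D⁺ , (λ τ′ → h⁺ τ′ σ * 𝕂.⟨ faces τ′ , unit τ ⟩) ⟩ *ₗ φ τ)
            ≈⟨ sub-cong ≈ᴹ-refl (pairing-additive (*ₗ-additiveʳ (φ τ)) D⁺ _) ⟩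
          (unit τ σ *ₗ φ τ) - ⟨ D⁺ , (λ τ′ → (h⁺ τ′ σ * 𝕂.⟨ faces τ′ , unit τ ⟩) *ₗ φ τ) ⟩
            ≈⟨ sub-cong ≈ᴹ-refl (⟨⟩-cong D⁺ (λ τ′ → ≈ᴹ-trans (*ₗ-assoc _ _ _)
                 (*ₗ-cong ≈-refl (pairing-additive (*ₗ-additiveʳ (φ τ)) (faces τ′) (unit τ))))) ⟩
          (unit τ σ *ₗ φ τ) - ⟨ D⁺ , (λ τ′ → h⁺ τ′ σ *ₗ ⟨ faces τ′ , (λ ρ → unit τ ρ *ₗ φ τ) ⟩) ⟩ ∎

        collapse : ∀ τ′ → Descending e τ′ →
          ⟨ D , (λ τ → ⟨ faces τ′ , (λ ρ → unit τ ρ *ₗ φ τ) ⟩) ⟩ ≈ᴹ ⟨ faces τ′ , φ ⟩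
        collapse τ′ dτ′ = ≈ᴹ-trans (⟨⟩-swap D (faces τ′) (λ τ ρ → unit τ ρ *ₗ φ τ))
          (Homotopy.faces-cong B +ᴹ-abelianGroup e τ′ dτ′ (apply-unit φ))

  -- The index is shifted: `Vanishing m` concerns cochains on `suc m` vertices, hence
  -- `ReducedNonzero` at `suc m`.
  Vanishing : ℕ → Set (c ⊔ ℓ)
  Vanishing m = (φ : Vec ∣B∣ (suc m) → K) → (∀ v → Descending e v → 𝕂.⟨ faces v , φ ⟩ ≈ 0#) →
    ¬ ¬ (∃[ ψ ] (∀ v → Descending e v → 𝕂.⟨ faces v , ψ ⟩ ≈ φ v))

  ¬ReducedNonzero⇒Vanishing : ∀ {m} → ¬ ReducedNonzero e (suc m) → Vanishing m
  ¬ReducedNonzero⇒Vanishing zero-cohomology φ cocycle = ¬¬-map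
    (λ coboundary → let ψ , δψ≈φ = IsCoboundary⇒Descending (φ ∘ reverse) coboundary in
      ψ , λ v dv → ≈-trans (δψ≈φ v dv) (CommutativeRing.reflexive 𝕜 (cong φ (reverse-involutive v))))
    (λ ¬coboundary → zero-cohomology (φ ∘ reverse , Descending⇒IsCocycle φ cocycle , ¬coboundary))

  contraction-above-size : ∀ {m} → size < suc m → ContractionAt m
  contraction-above-size size<m = record
    { h  = λ _ _ → 0#
    ; h⁺ = λ _ _ → 0#
    ; contracts = λ _ σ dσ → contradiction size<m (Descending-length σ dσ)
    }

  -- For each basis cochain, `z τ` is `unit τ` minus the contraction of its differential. As two
  -- differentials compose to zero, `z τ` is a cocycle, and a primitive of it is the row at `τ` of
  -- the new matrix.
  contraction-step : ∀ {m} → Vanishing m → ContractionAt (suc m) → ¬ ¬ ContractionAt m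
  contraction-step {m} vanishing C = ¬¬-map
    -- The old `h` sits one degree higher and becomes the new `h⁺`.
    (λ ψ → record { h = proj₁ ∘ ψ ; h⁺ = h ; contracts = proj₂ ∘ ψ })
    (¬¬-Vec (λ τ → vanishing (z τ) (z-cocycle τ)))
    where
    open ContractionAt C
    open Coefficients (TensorUnit.leftModule {R = ring}) using (apply; faces-apply)
    open AbelianGroupSolver +-abelianGroup using (solve; _:-_; _:=_; :0)
    open SetoidReasoning setoid

    δu : Vec ∣B∣ (suc m) → Vec ∣B∣ (suc (suc m)) → K
    δu τ v = 𝕂.⟨ faces v , unit τ ⟩

    z : Vec ∣B∣ (suc m) → Vec ∣B∣ (suc m) → K
    z τ σ = unit τ σ 𝕂.- apply h (δu τ) σ

    z-cocycle : ∀ τ v → Descending e v → 𝕂.⟨ faces v , z τ ⟩ ≈ 0#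
    z-cocycle τ v dv = begin
      𝕂.⟨ faces v , z τ ⟩
        ≈⟨ 𝕂.⟨⟩-sub (faces v) _ _ ⟩
      δu τ v 𝕂.- 𝕂.⟨ faces v , apply h (δu τ) ⟩
        ≈⟨ 𝕂.sub-cong ≈-refl (faces-apply C (δu τ) v dv) ⟩
      δu τ v 𝕂.- (δu τ v 𝕂.- apply h⁺ (λ w → 𝕂.⟨ faces w , δu τ ⟩) v)
        ≈⟨ 𝕂.sub-cong ≈-refl (𝕂.sub-cong ≈-refl (𝕂.⟨⟩-0 (descents _ e) (λ w →
             ≈-trans (*-congˡ (𝕂.faces-faces w (unit τ))) (zeroʳ (h⁺ w v))))) ⟩
      δu τ v 𝕂.- (δu τ v 𝕂.- 0#)
        ≈⟨ solve 1 (λ a → a :- (a :- :0) := :0) refl _ ⟩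
      0# ∎

  contraction : ∀ {n} → (∀ m → n ≤ m → Vanishing m) → ∀ {m} → n ≤ m → ¬ ¬ ContractionAt m
  -- With `size` steps the induction climbs from `m` to `size + m`, where the chains in question are
  -- too long to exist.
  contraction {n} vanishing {m} n≤m = descend size m n≤m (ℕ.m≤m+n size m)
    where
    descend : ∀ k m → n ≤ m → size ≤ k +ℕ m → ¬ ¬ ContractionAt m
    descend zero    m n≤m size≤ ¬C = ¬C (contraction-above-size (s≤s size≤))
    descend (suc k) m n≤m size≤ ¬C =
      descend k (suc m) (ℕ.m≤n⇒m≤1+n n≤m) (subst (size ≤_) (≡.sym (ℕ.+-suc k m)) size≤)
        (λ C → contraction-step (vanishing m n≤m) C ¬C)

-- The filtration of a module by supports

module SupportOrder (B : FiniteLRBMonoid) where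
  open LRB B
  open Descents B using (Descending-length)
  open Inverse enum using (to; from; strictlyInverseʳ)

  -- On vectors killed by `L`, `e ∙ b` then acts as `e` or as zero. This is how the rank-one action
  -- arises on a subquotient.
  Covered : Carrier → List Carrier → Set
  Covered e L = ∀ b → e ∙ b ≡ e ⊎ e ∙ b ∈ L

  -- A list in which supports increase from the tail to the head.
  Ordered : List Carrier → Set
  Ordered List.[]      = ⊤
  Ordered (e List.∷ L) = Covered e L × Ordered L

  -- An ordered list is thus a right ideal, and the vectors it kills form a submodule.
  Ordered-∙-closed : ∀ L → Ordered L → ∀ {a} → a ∈ L → ∀ b → a ∙ b ∈ L
  Ordered-∙-closed (e List.∷ L) (covered , ordered) (here refl) b with covered b
  ... | inj₁ eb≡e = here eb≡e
  ... | inj₂ eb∈L = there eb∈L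
  Ordered-∙-closed (e List.∷ L) (covered , ordered) (there a∈L) b = there (Ordered-∙-closed L ordered a∈L b)

  Extension : List Carrier → (List Carrier → Set) → Set
  Extension L P = ∃[ L′ ] (Ordered L′ × (∀ {a} → a ∈ L → a ∈ L′) × P L′)

  -- All products `e ∙ b` other than `e` are inserted first, then `e` is put on top. Each of them
  -- lies strictly below `e`, so the bound `k` on chain lengths drops by one.
  extend : ∀ k e → (∀ (v : Vec Carrier k) → ¬ Descending e v) → ∀ L → Ordered L → Extension L (e ∈_)
  extend zero    e short L ordered = contradiction tt (short [])
  extend (suc k) e short L ordered with cover (List.tabulate from)
    where
    cover : ∀ bs → Extension L (λ L′ → ∀ {b} → b ∈ bs → e ∙ b ≡ e ⊎ e ∙ b ∈ L′)
    cover List.[]       = L , ordered , (λ a∈L → a∈L) , λ ()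
    cover (b List.∷ bs) with cover bs | e ∙ b ≟ e
    ... | L₁ , ordered₁ , L⊆L₁ , covered | yes eb≡e =
      L₁ , ordered₁ , L⊆L₁ , λ { (here refl) → inj₁ eb≡e ; (there b∈bs) → covered b∈bs }
    ... | L₁ , ordered₁ , L⊆L₁ , covered | no eb≢e
      with extend k (e ∙ b) (λ v dv → short (e ∙ b ∷ v) ((∙-absorbs e b , eb≢e) , dv)) L₁ ordered₁
    ... | L₂ , ordered₂ , L₁⊆L₂ , eb∈L₂ =
      L₂ , ordered₂ , L₁⊆L₂ ∘ L⊆L₁ , λ { (here refl) → inj₂ eb∈L₂ ; (there b∈bs) → map₂ L₁⊆L₂ (covered b∈bs) }
  ... | L₁ , ordered₁ , L⊆L₁ , covered =
    e List.∷ L₁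
    , ((λ b → covered (subst (_∈ List.tabulate from) (strictlyInverseʳ b) (∈-tabulate⁺ (to b)))) , ordered₁)
    , there ∘ L⊆L₁
    , here refl

  ordered-with : ∀ e → ∃[ L ] (Ordered L × e ∈ L)
  ordered-with e with extend (suc size) e (λ v dv → Descending-length v dv ℕ.≤-refl) List.[] tt
  ... | L , ordered , _ , e∈L = L , ordered , e∈L

module Filtration {c ℓ a b} {𝕜 : CommutativeRing c ℓ} {B : FiniteLRBMonoid} (V : KBModule 𝕜 B a b) where
  open KBModule V
  open LeftModule kmodule
  open LRB B renaming (Carrier to ∣B∣)
  open SupportOrder B
  open MonoidCohomology V
  open BarDifferential V
  open Pairing +ᴹ-abelianGroup
  open Homotopy B +ᴹ-abelianGroup using (d; prism-homotopy; products-cong; products-faces; merges-Descending)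
  open AbelianGroupSolver +ᴹ-abelianGroup using (solve; _:+_; _:-_; _:=_; :0)
  open SetoidReasoning ≈ᴹ-setoid

  ▷-additive : ∀ b → Additive +ᴹ-abelianGroup +ᴹ-abelianGroup (b ▷_)
  ▷-additive b = record { α-cong = ▷-cong b ; α-+ = ▷-+ b }

  ▷-sub : ∀ b x y → b ▷ (x - y) ≈ᴹ (b ▷ x) - (b ▷ y)
  ▷-sub b = Additive.α-sub (▷-additive b)

  ▷-pairing : ∀ {n} b (t : Chain ∣B∣ n) f → b ▷ ⟨ t , f ⟩ ≈ᴹ ⟨ t , (λ v → b ▷ f v) ⟩
  ▷-pairing b = pairing-additive (▷-additive b)

  ∂-sub : ∀ {n} (f g : BCochain n) bs → ∂ (λ v → f v - g v) bs ≈ᴹ ∂ f bs - ∂ g bs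
  ∂-sub f g (b ∷ bs) = begin
    ∂ (λ v → f v - g v) (b ∷ bs)
      ≈⟨ ∂-merges _ b bs ⟩
    (b ▷ (f bs - g bs)) - ⟨ merges _∙_ b bs , (λ v → f v - g v) ⟩
      ≈⟨ sub-cong (▷-sub b _ _) (⟨⟩-sub (merges _∙_ b bs) f g) ⟩
    ((b ▷ f bs) - (b ▷ g bs)) - (⟨ merges _∙_ b bs , f ⟩ - ⟨ merges _∙_ b bs , g ⟩)
      ≈⟨ solve 4 (λ p q r s → (p :- q) :- (r :- s) := (p :- r) :- (q :- s)) refl _ _ _ _ ⟩
    ((b ▷ f bs) - ⟨ merges _∙_ b bs , f ⟩) - ((b ▷ g bs) - ⟨ merges _∙_ b bs , g ⟩)
      ≈⟨ sub-cong (∂-merges f b bs) (∂-merges g b bs) ⟨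
    ∂ f (b ∷ bs) - ∂ g (b ∷ bs) ∎

  ∂-+ : ∀ {n} (f g : BCochain n) bs → ∂ (λ v → f v +ᴹ g v) bs ≈ᴹ ∂ f bs +ᴹ ∂ g bs
  ∂-+ f g (b ∷ bs) = begin
    ∂ (λ v → f v +ᴹ g v) (b ∷ bs)
      ≈⟨ ∂-merges _ b bs ⟩
    (b ▷ (f bs +ᴹ g bs)) - ⟨ merges _∙_ b bs , (λ v → f v +ᴹ g v) ⟩
      ≈⟨ sub-cong (▷-+ b _ _) (⟨⟩-+ (merges _∙_ b bs) f g) ⟩
    ((b ▷ f bs) +ᴹ (b ▷ g bs)) - (⟨ merges _∙_ b bs , f ⟩ +ᴹ ⟨ merges _∙_ b bs , g ⟩)
      ≈⟨ solve 4 (λ p q r s → (p :+ q) :- (r :+ s) := (p :- r) :+ (q :- s)) refl _ _ _ _ ⟩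
    ((b ▷ f bs) - ⟨ merges _∙_ b bs , f ⟩) +ᴹ ((b ▷ g bs) - ⟨ merges _∙_ b bs , g ⟩)
      ≈⟨ +ᴹ-cong (∂-merges f b bs) (∂-merges g b bs) ⟨
    ∂ f (b ∷ bs) +ᴹ ∂ g (b ∷ bs) ∎

  ▷-∂ : ∀ {n} x (f : BCochain n) b bs →
    x ▷ ∂ f (b ∷ bs) ≈ᴹ ((x ∙ b) ▷ f bs) - ⟨ merges _∙_ b bs , (λ v → x ▷ f v) ⟩
  ▷-∂ x f b bs = begin
    x ▷ ∂ f (b ∷ bs)                                          ≈⟨ ▷-cong x (∂-merges f b bs) ⟩
    x ▷ ((b ▷ f bs) - ⟨ merges _∙_ b bs , f ⟩)                 ≈⟨ ▷-sub x _ _ ⟩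
    (x ▷ b ▷ f bs) - (x ▷ ⟨ merges _∙_ b bs , f ⟩)             ≈⟨ sub-cong (≈ᴹ-sym (▷-assoc x b _)) (▷-pairing x (merges _∙_ b bs) f) ⟩
    ((x ∙ b) ▷ f bs) - ⟨ merges _∙_ b bs , (λ v → x ▷ f v) ⟩   ∎

  ∂∂≈0 : ∀ {n} (f : BCochain n) bs → ∂ (∂ f) bs ≈ᴹ 0ᴹ
  ∂∂≈0 f (a ∷ b ∷ bs) = begin
    ∂ (∂ f) (a ∷ b ∷ bs)
      ≈⟨ ∂-merges (∂ f) a (b ∷ bs) ⟩
    (a ▷ ∂ f (b ∷ bs)) - (∂ f (a ∙ b ∷ bs) - ⟨ merges _∙_ b bs , (λ v → ∂ f (a ∷ v)) ⟩)
      ≈⟨ sub-cong (▷-∂ a f b bs) (sub-cong (∂-merges f (a ∙ b) bs)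
           (≈ᴹ-trans (⟨⟩-cong (merges _∙_ b bs) (∂-merges f a))
             (≈ᴹ-trans (⟨⟩-sub (merges _∙_ b bs) _ _) (sub-cong ≈ᴹ-refl (merges-merges assoc a b bs f))))) ⟩
    (x - s) - ((x - t) - (s - t))
      ≈⟨ solve 3 (λ x s t → (x :- s) :- ((x :- t) :- (s :- t)) := :0) refl x s t ⟩
    0ᴹ ∎
    where
    x = (a ∙ b) ▷ f bs
    s = ⟨ merges _∙_ b bs , (λ v → a ▷ f v) ⟩
    t = ⟨ merges _∙_ (a ∙ b) bs , f ⟩

  Killed : List ∣B∣ → ∀ {n} → BCochain n → Set b
  Killed L f = ∀ {x} → x ∈ L → ∀ bs → x ▷ f bs ≈ᴹ 0ᴹ

  Killed-∂ : ∀ {L n} → Ordered L → (g : BCochain n) → Killed L g → Killed L (∂ g)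
  Killed-∂ {L} ordered g killed {x} x∈L (b ∷ bs) = begin
    x ▷ ∂ g (b ∷ bs)                                           ≈⟨ ▷-∂ x g b bs ⟩
    ((x ∙ b) ▷ g bs) - ⟨ merges _∙_ b bs , (λ v → x ▷ g v) ⟩
      ≈⟨ sub-cong (killed (Ordered-∙-closed L ordered x∈L b) bs) (⟨⟩-0 (merges _∙_ b bs) (killed x∈L)) ⟩
    0ᴹ - 0ᴹ                                                    ≈⟨ solve 0 (:0 :- :0 := :0) refl ⟩
    0ᴹ                                                         ∎

  -- The vectors killed by `L`, modulo those killed by `e` as well, embed into `V` by `e ▷_`. So it
  -- suffices to find `g` killed by `L` with `e ▷ ∂ g` equal to `e ▷ f`.
  module Step {m} (e : ∣B∣) (C : Contraction.ContractionAt 𝕜 B e m) (L : List ∣B∣) (covered : Covered e L)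
              (f : BCochain (suc m)) (cocycle : IsBCocycle f) (killed : Killed L f) where
    open Contraction 𝕜 B e
    open ContractionAt C
    open Coefficients kmodule
    open Descents B using (descents; descents-cong)

    φ : BCochain (suc m)
    φ v = e ▷ f v

    -- For `x` below `e` the product `e ∙ x` lies in `L` and kills the leading term of `e ▷ ∂ f`;
    -- the other terms are the simplicial differential.
    φ-cocycle : ∀ v → Descending e v → ⟨ faces v , φ ⟩ ≈ᴹ 0ᴹ
    φ-cocycle (x ∷ xs) dv@((ex≡x , x≢e) , _) = begin
      ⟨ faces (x ∷ xs) , φ ⟩                             ≈⟨ merges-Descending e x xs dv φ ⟨
      ⟨ merges _∙_ x xs , φ ⟩                            ≈⟨ solve 2 (λ p q → q := p :- (p :- q)) refl ((e ∙ x) ▷ f xs) _ ⟩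
      y - (y - ⟨ merges _∙_ x xs , φ ⟩)                  ≈⟨ sub-cong (y≈0 (covered x)) (≈ᴹ-sym (▷-∂ e f x xs)) ⟩
      0ᴹ - (e ▷ ∂ f (x ∷ xs))                            ≈⟨ sub-cong ≈ᴹ-refl (▷-cong e (cocycle (x ∷ xs))) ⟩
      0ᴹ - (e ▷ 0ᴹ)                                      ≈⟨ sub-cong ≈ᴹ-refl (Additive.α-0 (▷-additive e)) ⟩
      0ᴹ - 0ᴹ                                            ≈⟨ solve 0 (:0 :- :0 := :0) refl ⟩
      0ᴹ                                                 ∎
      where
      y = (e ∙ x) ▷ f xs
      y≈0 : e ∙ x ≡ e ⊎ e ∙ x ∈ L → y ≈ᴹ 0ᴹ
      y≈0 (inj₁ ex≡e) = contradiction (≡.trans (≡.sym ex≡x) ex≡e) x≢e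
      y≈0 (inj₂ ex∈L) = killed ex∈L xs

    ▷-apply : ∀ b σ → b ▷ apply h f σ ≈ᴹ apply h (λ v → b ▷ f v) σ
    ▷-apply b σ = ≈ᴹ-trans (▷-pairing b (descents (suc m) e) _) (⟨⟩-cong (descents (suc m) e) (λ τ → ▷-*ₗ b _ _))

    -- This is `apply h φ`, as the action commutes with scalars, in the form that `e ▷ g` produces.
    ψ : BCochain m
    ψ σ = e ▷ apply h f σ

    faces-ψ : ∀ v → Descending e v → ⟨ faces v , ψ ⟩ ≈ᴹ φ v
    faces-ψ v dv = begin
      ⟨ faces v , ψ ⟩                                     ≈⟨ ⟨⟩-cong (faces v) (▷-apply e) ⟩
      ⟨ faces v , apply h φ ⟩                             ≈⟨ faces-apply C φ v dv ⟩
      φ v - apply h⁺ (λ w → ⟨ faces w , φ ⟩) v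
        ≈⟨ sub-cong ≈ᴹ-refl (≈ᴹ-trans
             (descents-cong +ᴹ-abelianGroup e (λ w dw → *ₗ-cong (CommutativeRing.refl 𝕜) (φ-cocycle w dw)))
             (⟨⟩-0 (descents (suc (suc m)) e) (λ w → *ₗ-zeroʳ _))) ⟩
      φ v - 0ᴹ                                            ≈⟨ solve 1 (λ a → a :- :0 := a) refl _ ⟩
      φ v                                                 ∎

    -- After applying `e`, the differential of the prism term is `φ` minus its pullback from chains,
    -- and that of the second term is minus this pullback. The difference is `φ`.
    g : BCochain m
    g bs = ⟨ prism e bs , f ⟩ - ⟨ products e bs , apply h f ⟩

    ▷-g : ∀ x bs → x ▷ g bs ≈ᴹ ⟨ prism e bs , (λ v → x ▷ f v) ⟩ - ⟨ products e bs , (λ v → x ▷ apply h f v) ⟩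
    ▷-g x bs = ≈ᴹ-trans (▷-sub x _ _) (sub-cong (▷-pairing x (prism e bs) f) (▷-pairing x (products e bs) (apply h f)))

    g-killed : Killed L g
    g-killed {x} x∈L bs = begin
      x ▷ g bs
        ≈⟨ ▷-g x bs ⟩
      ⟨ prism e bs , (λ v → x ▷ f v) ⟩ - ⟨ products e bs , (λ v → x ▷ apply h f v) ⟩
        ≈⟨ sub-cong (⟨⟩-0 (prism e bs) (killed x∈L)) (⟨⟩-0 (products e bs) (λ v → ≈ᴹ-trans (▷-apply x v)
             (⟨⟩-0 (descents (suc m) e) (λ τ → ≈ᴹ-trans (*ₗ-cong (CommutativeRing.refl 𝕜) (killed x∈L τ)) (*ₗ-zeroʳ _))))) ⟩
      0ᴹ - 0ᴹ
        ≈⟨ solve 0 (:0 :- :0 := :0) refl ⟩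
      0ᴹ ∎

    ▷∂g≈▷f : ∀ bs → e ▷ ∂ g bs ≈ᴹ e ▷ f bs
    ▷∂g≈▷f (b ∷ bs) = begin
      e ▷ ∂ g (b ∷ bs)
        ≈⟨ ▷-∂ e g b bs ⟩
      w - ⟨ merges _∙_ b bs , (λ v → e ▷ g v) ⟩
        ≈⟨ sub-cong ≈ᴹ-refl (≈ᴹ-trans (⟨⟩-cong (merges _∙_ b bs) (▷-g e)) (⟨⟩-sub (merges _∙_ b bs) _ _)) ⟩
      w - (p - q)
        -- The leading term `w` is split as `u - (u - w)`: `u` belongs to the prism homotopy, and
        -- `u - w` is the abstract term in `products-faces`.
        ≈⟨ solve 4 (λ w u p q → w :- (p :- q) := ((u :- p) :+ :0) :- ((u :- w) :- q)) refl w u p q ⟩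
      ((u - p) +ᴹ 0ᴹ) - ((u - w) - q)
        ≈⟨ sub-cong (≈ᴹ-trans (+ᴹ-cong ≈ᴹ-refl (≈ᴹ-sym (⟨⟩-0 (prism e (b ∷ bs)) dF≈0))) (prism-homotopy F e b bs))
                    (≈ᴹ-trans (products-faces e b bs ψ (u - w) fix move) (sub-cong ≈ᴹ-refl (products-cong e (b ∷ bs) faces-ψ))) ⟩
      (φ (b ∷ bs) - ⟨ products e (b ∷ bs) , φ ⟩) - (0ᴹ - ⟨ products e (b ∷ bs) , φ ⟩)
        ≈⟨ solve 2 (λ f p → (f :- p) :- (:0 :- p) := f) refl _ _ ⟩
      φ (b ∷ bs) ∎
      where
      F : ∣B∣ → BCochain (suc m)
      F x v = x ▷ f v
      w = (e ∙ b) ▷ g bs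
      u = ⟨ prism (e ∙ b) bs , F (e ∙ b) ⟩
      p = ⟨ merges _∙_ b bs , (λ v → ⟨ prism e v , F e ⟩) ⟩
      q = ⟨ merges _∙_ b bs , (λ v → ⟨ products e v , ψ ⟩) ⟩

      dF≈0 : ∀ v → d F e v ≈ᴹ 0ᴹ
      dF≈0 (x ∷ v) = ≈ᴹ-trans (≈ᴹ-sym (▷-∂ e f x v)) (≈ᴹ-trans (▷-cong e (cocycle (x ∷ v))) (Additive.α-0 (▷-additive e)))

      fix : e ∙ b ≡ e → u - w ≈ᴹ ⟨ products e bs , ψ ⟩
      fix eb≡e = begin
        u - w
          ≈⟨ sub-cong (≈ᴹ-reflexive (cong (λ x → ⟨ prism x bs , F x ⟩) eb≡e))
                      (≈ᴹ-trans (≈ᴹ-reflexive (cong (_▷ g bs) eb≡e)) (▷-g e bs)) ⟩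
        ⟨ prism e bs , F e ⟩ - (⟨ prism e bs , F e ⟩ - ⟨ products e bs , ψ ⟩)
          ≈⟨ solve 2 (λ p q → p :- (p :- q) := q) refl _ _ ⟩
        ⟨ products e bs , ψ ⟩ ∎

      move : ¬ e ∙ b ≡ e → u - w ≈ᴹ 0ᴹ
      move eb≢e with covered b
      ... | inj₁ eb≡e = contradiction eb≡e eb≢e
      ... | inj₂ eb∈L = ≈ᴹ-trans (sub-cong (⟨⟩-0 (prism (e ∙ b) bs) (killed eb∈L)) (g-killed eb∈L bs))
                                 (solve 0 (:0 :- :0 := :0) refl)

  -- The tail is treated first. The correction for the head `e` keeps what has been gained, since
  -- `g` and hence `∂ g` are killed by the tail.
  reduce : ∀ {m} → (∀ e → Contraction.ContractionAt 𝕜 B e m) → ∀ L → Ordered L →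
    (f : BCochain (suc m)) → IsBCocycle f → ∃[ g ] Killed L (λ bs → f bs - ∂ g bs)
  reduce C List.[]      _                   f cocycle = (λ _ → 0ᴹ) , λ ()
  reduce C (e List.∷ L) (covered , ordered) f cocycle = (λ bs → g₀ bs +ᴹ g bs) , killed′
    where
    g₀ = proj₁ (reduce C L ordered f cocycle)
    f₀ : BCochain _
    f₀ bs = f bs - ∂ g₀ bs
    killed : Killed L f₀
    killed = proj₂ (reduce C L ordered f cocycle)
    f₀-cocycle : IsBCocycle f₀
    f₀-cocycle bs = ≈ᴹ-trans (∂-sub f (∂ g₀) bs)
      (≈ᴹ-trans (sub-cong (cocycle bs) (∂∂≈0 g₀ bs)) (solve 0 (:0 :- :0 := :0) refl))
    open Step e (C e) L covered f₀ f₀-cocycle killed using (g; g-killed; ▷∂g≈▷f)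

    ▷-difference : ∀ x bs → x ▷ (f bs - ∂ (λ v → g₀ v +ᴹ g v) bs) ≈ᴹ (x ▷ f₀ bs) - (x ▷ ∂ g bs)
    ▷-difference x bs = ≈ᴹ-trans
      (▷-cong x (≈ᴹ-trans (sub-cong ≈ᴹ-refl (∂-+ g₀ g bs)) (solve 3 (λ a b c → a :- (b :+ c) := (a :- b) :- c) refl _ _ _)))
      (▷-sub x _ _)

    killed′ : Killed (e List.∷ L) (λ bs → f bs - ∂ (λ v → g₀ v +ᴹ g v) bs)
    killed′ (here refl)     bs = ≈ᴹ-trans (▷-difference e bs) (≈ᴹ-trans (sub-cong ≈ᴹ-refl (▷∂g≈▷f bs)) (solve 1 (λ a → a :- a := :0) refl _))
    killed′ {x} (there x∈L) bs = ≈ᴹ-trans (▷-difference x bs)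
      (≈ᴹ-trans (sub-cong (killed x∈L bs) (Killed-∂ ordered g g-killed x∈L bs)) (solve 0 (:0 :- :0 := :0) refl))

  -- A list containing `ε` kills only zero, so the remainder left by `reduce` vanishes.
  contractions⇒coboundary : ∀ {m} → (∀ e → Contraction.ContractionAt 𝕜 B e m) →
    (f : BCochain (suc m)) → IsBCocycle f → IsBCoboundary f
  contractions⇒coboundary C f cocycle =
    let L , ordered , ε∈L = ordered-with ε
        g , killed        = reduce C L ordered f cocycle
    in g , λ bs → begin
      ∂ g bs                     ≈⟨ solve 2 (λ f g → g := f :- (f :- g)) refl (f bs) _ ⟩
      f bs - (f bs - ∂ g bs)     ≈⟨ sub-cong ≈ᴹ-refl (≈ᴹ-trans (≈ᴹ-sym (▷-ε _)) (killed ε∈L bs)) ⟩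
      f bs - 0ᴹ                  ≈⟨ solve 1 (λ a → a :- :0 := a) refl _ ⟩
      f bs                       ∎

-- Combination of the two bounds on the cohomological dimension

theorem10p1 : ∀ {c ℓ a b : Level} (𝕜 : CommutativeRing c ℓ) (B : FiniteLRBMonoid) (n : ℕ)
    → (∃[ e ] ReducedCohomology.ReducedNonzero 𝕜 B e n)
    → (∀ e n′ → ReducedCohomology.ReducedNonzero 𝕜 B e n′ → n′ ≤ n)
    → (Σ (KBModule 𝕜 B c ℓ) (λ V → MonoidCohomology.CohomNonzero V n))
    × (∀ (V : KBModule 𝕜 B a b) n′ → MonoidCohomology.CohomNonzero V n′ → n′ ≤ n)
theorem10p1 𝕜 B n (e , nonzero) maximal = (RankOneModule.rankOne 𝕜 B e , RankOneModule.ReducedNonzero⇒CohomNonzero 𝕜 B e nonzero) , bound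
  where
  bound : ∀ (V : KBModule 𝕜 B _ _) n′ → MonoidCohomology.CohomNonzero V n′ → n′ ≤ n
  bound V zero    _ = z≤n
  bound V (suc m) (f , cocycle , ¬coboundary) with suc m ≤? n
  ... | yes m<n = m<n
  -- The case is to be refuted, so contractions known up to double negation suffice; `¬¬-Carrier`
  -- collects them over all `e`.
  ... | no  m≮n = contradiction (λ C → ¬coboundary (Filtration.contractions⇒coboundary V C f cocycle))
    (Descents.¬¬-Carrier B (λ e → Contraction.contraction 𝕜 B e vanishing (ℕ.≮⇒≥ m≮n)))
    where
    vanishing : ∀ {e} k → n ≤ k → Contraction.Vanishing 𝕜 B e k
    vanishing {e} k n≤k = Contraction.¬ReducedNonzero⇒Vanishing 𝕜 B e (λ nonzero → ℕ.<⇒≱ (s≤s n≤k) (maximal e (suc k) nonzero))
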